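{- Suppose that $\theta$ is a large enough regular cardinal, that $(X,\tau)\in H(\theta)$ is a Menger space, and that $\mathbb{P}\in H(\theta)$ is a poset. Suppose further that the set of countable $M\prec H(\theta)$ such that $\mathbb{P}$ is strongly proper for $M$ is stationary in $[H(\theta)]^{\aleph_0}$. Then $\mathbb{P}$ forces that $(X,\tau)$ is Menger.
   Context: $H(\theta)$ is the collection of sets hereditarily of cardinality $<\theta$; "large enough" has its usual meaning ($\theta\ge\omega_2$ and $H(\theta)$ contains all relevant objects, such as power sets, topologies, and names built from $\mathbb{P}$ and $X$). Strong properness. Let $M\prec H(\theta)$ be countable with $\mathbb{P}\in M$. For $q\in\mathbb{P}$, a condition $\bar q\in M\cap\mathbb{P}$ is a residue of $q$ to $M$ if every $s\le\bar q$ with $s\in M$ is compatible with $q$. A condition $p\in\mathbb{P}$ is $(M,\mathbb{P})$-strongly generic if every $q\le p$ has a residue to $M$. $\mathbb{P}$ is strongly proper for $M$ if every $s\in M\cap\mathbb{P}$ can be extended to an $(M,\mathbb{P})$-strongly generic condition. Preservation. If $G$ is $V$-generic over $\mathbb{P}$, then $\tau^G$ denotes the topology on $X$ in $V[G]$ having $\tau$ as a basis. "$\mathbb{P}$ forces that $(X,\tau)$ has property $\Phi$" means that every condition forces that $(X,\tau^{\dot G})$ has property $\Phi$. A space $X$ is Menger if for every sequence $\langle\mathcal{U}_n:n\in\omega\rangle$ of open covers of $X$ there are finite subsets $\mathcal{F}_n\subseteq\mathcal{U}_n$ such that $X=\bigcup_n\bigcup\mathcal{F}_n$. -}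

module Defs where

open import Level using (Level; 0ℓ; Lift) renaming (suc to lsuc; _⊔_ to _⊔ˡ_)
open import Data.Bool.Base using (Bool; true; false; T; if_then_else_)
open import Data.Empty using (⊥)
open import Data.Fin.Base using (Fin)
open import Data.Nat.Base using (ℕ; zero; suc)
open import Data.Product.Base using (Σ; ∃; ∃-syntax; _×_; _,_; proj₁; proj₂)
open import Data.Sum.Base using (_⊎_; inj₁; inj₂; [_,_]′)
open import Data.Unit.Base using (⊤)
open import Data.Vec.Functional using (_∷_)
open import Function.Base using (_∘_)
open import Function.Bundles using (Func; Injection; Inverse; _⇔_)
open import Relation.Binary.Bundles using (Setoid; Poset)
open import Relation.Binary.Definitions using (_Respects_)
open import Relation.Binary.PropositionalEquality.Core using (_≡_)
open import Relation.Binary.PropositionalEquality.Properties as ≡ using ()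
open import Relation.Binary.Structures using (IsPartialOrder)
open import Relation.Nullary.Negation.Core using (¬_)
open import Relation.Unary using (Pred)

-- The axiom of choice for sets given as setoids: every equivalence relation
-- has a system of representatives.  (Choice along Σ is a theorem of type
-- theory; this extensional form is not.)
Choice : ∀ a ℓ → Set (lsuc (a ⊔ˡ ℓ))
Choice a ℓ = (S : Setoid a ℓ) → let open Setoid S in
  Σ (Carrier → Carrier) λ r →
    (∀ x → r x ≈ x) × (∀ x y → x ≈ y → r x ≡ r y)

-- The universe of sets: Aczel's iterative sets.  Given excluded middle and
-- Choice, V is a model of ZFC with ≐ as equality.

data V : Set₁ where
  sup : (A : Set) → (A → V) → V

Index : V → Set
Index (sup A f) = A

elem : (x : V) → Index x → V
elem (sup A f) = f

infix 4 _≐_ _∈_ _⊆_ _≤ᶜ_ _<ᶜ_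

_≐_ : V → V → Set
sup A f ≐ sup B g =
  (∀ a → ∃[ b ] f a ≐ g b) × (∀ b → ∃[ a ] f a ≐ g b)

_∈_ : V → V → Set
x ∈ y = ∃[ b ] x ≐ elem y b

_⊆_ : V → V → Set
x ⊆ y = ∀ a → elem x a ∈ y

≐-refl : ∀ x → x ≐ x
≐-refl (sup A f) = (λ a → a , ≐-refl (f a)) , (λ a → a , ≐-refl (f a))

≐-sym : ∀ x y → x ≐ y → y ≐ x
≐-sym (sup A f) (sup B g) (l , r) =
  (λ b → proj₁ (r b) , ≐-sym (f _) (g b) (proj₂ (r b))) ,
  (λ a → proj₁ (l a) , ≐-sym (f a) (g _) (proj₂ (l a)))

≐-trans : ∀ x y z → x ≐ y → y ≐ z → x ≐ z
≐-trans (sup A f) (sup B g) (sup C h) (l , r) (l′ , r′) =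
  (λ a → let b , p = l a ; c , q = l′ b in c , ≐-trans (f a) (g b) (h c) p q) ,
  (λ c → let b , q = r′ c ; a , p = r b in a , ≐-trans (f a) (g b) (h c) p q)

-- The elements of x: distinct indices may name the same element.
El : V → Setoid 0ℓ 0ℓ
El x = record
  { Carrier = Index x
  ; _≈_ = λ a b → elem x a ≐ elem x b
  ; isEquivalence = record
    { refl = λ {a} → ≐-refl (elem x a)
    ; sym = λ {a} {b} → ≐-sym (elem x a) (elem x b)
    ; trans = λ {a} {b} {c} → ≐-trans (elem x a) (elem x b) (elem x c)
    }
  }

∅ : V
∅ = sup ⊥ λ ()

｛_,_｝ : V → V → V
｛ x , y ｝ = sup Bool λ b → if b then x else y

⟨_,_⟩ : V → V → V
⟨ x , y ⟩ = ｛ ｛ x , x ｝ , ｛ x , y ｝ ｝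

_∪_ : V → V → V
x ∪ y = sup (Index x ⊎ Index y) [ elem x , elem y ]′

⋃ : (ℕ → V) → V
⋃ N = sup (Σ ℕ (Index ∘ N)) λ (n , a) → elem (N n) a

_⊗_ : V → V → V
x ⊗ y = sup (Index x × Index y) λ (a , b) → ⟨ elem x a , elem y b ⟩

-- By excluded middle every subset is given by a Bool-valued characteristic
-- function.
𝒫 : V → V
𝒫 x = sup (Index x → Bool) λ χ →
  sup (Σ (Index x) λ a → T (χ a)) (elem x ∘ proj₁)

numeral : ℕ → V
numeral zero = ∅
numeral (suc n) = numeral n ∪ ｛ numeral n , numeral n ｝

ω : V
ω = sup ℕ numeral

trcl : V → V
trcl (sup A f) =
  sup (Σ A λ a → ⊤ ⊎ Index (trcl (f a)))
      λ (a , s) → [ (λ _ → f a) , elem (trcl (f a)) ]′ s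

_≤ᶜ_ : V → V → Set
x ≤ᶜ y = Injection (El x) (El y)

_<ᶜ_ : V → V → Set
x <ᶜ y = x ≤ᶜ y × ¬ (y ≤ᶜ x)

IsTransitive : V → Set
IsTransitive x = ∀ a → elem x a ⊆ x

IsOrdinal : V → Set
IsOrdinal α = IsTransitive α × (∀ a → IsTransitive (elem α a))

IsCardinal : V → Set
IsCardinal κ = IsOrdinal κ × (∀ a → ¬ (κ ≤ᶜ elem κ a))

IsCardinalSuccessor : V → V → Set₁
IsCardinalSuccessor κ ν =
  IsCardinal ν × κ ∈ ν × (∀ μ → IsCardinal μ → κ ∈ μ → ν ⊆ μ)

-- Infinite, and no function from a smaller ordinal is cofinal.
IsRegular : V → Set
IsRegular κ =
  IsCardinal κ × ω ⊆ κ ×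
  (∀ α (f : Func (El (elem κ α)) (El κ)) →
     ∃[ β ] ∀ i → elem κ (Func.to f i) ∈ elem κ β)

H : V → Pred V 0ℓ
H θ x = trcl x <ᶜ θ

-- The relevant objects are power sets and nice names; nice names for sequences
-- of families of basic open sets are given by subsets of (ω ⊗ τ) ⊗ P.
record LargeEnough (θ X τ P : V) : Set₁ where
  field
    ω₂≤θ : ∃[ ω₁ ] ∃[ ω₂ ]
      IsCardinalSuccessor ω ω₁ × IsCardinalSuccessor ω₁ ω₂ × ω₂ ⊆ θ
    𝒫X∈H : H θ (𝒫 X)
    𝒫τ∈H : H θ (𝒫 τ)
    𝒫P∈H : H θ (𝒫 P)
    names∈H : H θ (𝒫 ((ω ⊗ τ) ⊗ P))

data Formula (n : ℕ) : Set where
  _∈ᶠ_ _≐ᶠ_ : Fin n → Fin n → Formula n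
  ⊥ᶠ        : Formula n
  _⇒ᶠ_      : Formula n → Formula n → Formula n
  ∀ᶠ        : Formula (suc n) → Formula n

_⊨_[_] : ∀ {n} → Pred V 0ℓ → Formula n → (Fin n → V) → Set₁
D ⊨ i ∈ᶠ j [ ρ ] = Lift _ (ρ i ∈ ρ j)
D ⊨ i ≐ᶠ j [ ρ ] = Lift _ (ρ i ≐ ρ j)
D ⊨ ⊥ᶠ     [ ρ ] = Lift _ ⊥
D ⊨ φ ⇒ᶠ ψ [ ρ ] = D ⊨ φ [ ρ ] → D ⊨ ψ [ ρ ]
D ⊨ ∀ᶠ φ   [ ρ ] = ∀ x → D x → D ⊨ φ [ x ∷ ρ ]

infix 4 _≺H_

_≺H_ : V → V → Set₁
M ≺H θ = (∀ a → H θ (elem M a)) ×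
  (∀ {n} (φ : Formula n) (ρ : Fin n → V) → (∀ i → ρ i ∈ M) →
     ((_∈ M) ⊨ φ [ ρ ]) ⇔ (H θ ⊨ φ [ ρ ]))

IsCountable : V → Set
IsCountable M = Inverse (≡.setoid ℕ) (El M)

[H_]^ℵ₀ : V → Pred V 0ℓ
[H θ ]^ℵ₀ M = (∀ a → H θ (elem M a)) × IsCountable M

record IsClub (θ : V) (C : Pred V (lsuc 0ℓ)) : Set₁ where
  field
    respects  : C Respects _≐_
    subset    : ∀ M → C M → [H θ ]^ℵ₀ M
    unbounded : ∀ M → [H θ ]^ℵ₀ M → ∃[ N ] C N × M ⊆ N
    closed    : ∀ (N : ℕ → V) → (∀ n → C (N n)) →
                (∀ n → N n ⊆ N (suc n)) → C (⋃ N)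

IsStationary : V → Pred V (lsuc 0ℓ) → Set₂
IsStationary θ S = ∀ C → IsClub θ C → ∃[ M ] C M × S M

-- The notions to be evaluated both in V and in its generic extensions are
-- written once, over an arbitrary interpretation of the language of sets:
-- D is the domain of quantification and Ω the type of truth values.

record Interpretation : Set₃ where
  infix  6 _∈̇_ _≐̇_
  infixr 5 _∧̇_ _∨̇_
  infixr 4 _⇒̇_
  field
    D : Set₁
    Ω : Set₂
    _∈̇_ _≐̇_ : D → D → Ω
    ⊥̇ : Ω
    _∧̇_ _∨̇_ _⇒̇_ : Ω → Ω → Ω
    ∀̇ ∃̇ : (D → Ω) → Ω

module SetLanguage (I : Interpretation) where
  open Interpretation I

  infixr 4 _⇔̇_
  infix  6 _⊆̇_

  _⇔̇_ : Ω → Ω → Ω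
  φ ⇔̇ ψ = (φ ⇒̇ ψ) ∧̇ (ψ ⇒̇ φ)

  ∀∈ ∃∈ : D → (D → Ω) → Ω
  ∀∈ a φ = ∀̇ λ x → x ∈̇ a ⇒̇ φ x
  ∃∈ a φ = ∃̇ λ x → x ∈̇ a ∧̇ φ x

  _⊆̇_ : D → D → Ω
  a ⊆̇ b = ∀∈ a λ x → x ∈̇ b

  IsEmpty : D → Ω
  IsEmpty z = ∀̇ λ x → x ∈̇ z ⇒̇ ⊥̇

  -- z = x ∪ {x}
  IsSuccessor : D → D → Ω
  IsSuccessor z x = ∀̇ λ y → y ∈̇ z ⇔̇ (y ∈̇ x ∨̇ y ≐̇ x)

  -- z = {x , y}
  IsPair : D → D → D → Ω
  IsPair z x y = ∀̇ λ w → w ∈̇ z ⇔̇ (w ≐̇ x ∨̇ w ≐̇ y)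

  -- z = ⟨x , y⟩
  IsOrderedPair : D → D → D → Ω
  IsOrderedPair z x y = ∀̇ λ w → w ∈̇ z ⇔̇ (IsPair w x x ∨̇ IsPair w x y)

  IsInductive : D → Ω
  IsInductive a =
    (∃∈ a λ z → IsEmpty z) ∧̇ (∀∈ a λ x → ∃∈ a λ y → IsSuccessor y x)

  Isω : D → Ω
  Isω w = IsInductive w ∧̇ (∀̇ λ a → IsInductive a ⇒̇ w ⊆̇ a)

  -- ⟨x , y⟩ ∈ f
  _⟨_⟩↦_ : D → D → D → Ω
  f ⟨ x ⟩↦ y = ∃∈ f λ z → IsOrderedPair z x y

  IsFunctionOn : D → D → Ω
  IsFunctionOn f d =
    (∀∈ f λ z → ∃∈ d λ x → ∃̇ λ y → IsOrderedPair z x y) ∧̇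
    (∀∈ d λ x → ∃̇ λ y → f ⟨ x ⟩↦ y ∧̇ (∀̇ λ y′ → f ⟨ x ⟩↦ y′ ⇒̇ y′ ≐̇ y))

  -- F is finite: F = {g(k) : k ∈ n} for some n ∈ w = ω and function g on n.
  IsFinite : D → D → Ω
  IsFinite w F = ∃∈ w λ n → ∃̇ λ g → IsFunctionOn g n ∧̇
    (∀̇ λ y → y ∈̇ F ⇔̇ (∃∈ n λ k → g ⟨ k ⟩↦ y))

  IsTopology : D → D → Ω
  IsTopology X σ =
    (∀∈ σ λ U → U ⊆̇ X) ∧̇
    X ∈̇ σ ∧̇
    (∀̇ λ A → A ⊆̇ σ ⇒̇
      ∃∈ σ λ U → ∀̇ λ x → x ∈̇ U ⇔̇ (∃∈ A λ W → x ∈̇ W)) ∧̇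
    (∀∈ σ λ U → ∀∈ σ λ W →
      ∃∈ σ λ Z → ∀̇ λ x → x ∈̇ Z ⇔̇ (x ∈̇ U ∧̇ x ∈̇ W))

  IsBasis : D → D → Ω
  IsBasis β σ =
    β ⊆̇ σ ∧̇
    (∀∈ σ λ U → ∀∈ U λ x → ∃∈ β λ W → x ∈̇ W ∧̇ W ⊆̇ U)

  IsOpenCover : D → D → D → Ω
  IsOpenCover X σ 𝒰 = 𝒰 ⊆̇ σ ∧̇ (∀∈ X λ x → ∃∈ 𝒰 λ U → x ∈̇ U)

  -- u is the sequence of covers, f the sequence of finite subfamilies.
  IsMenger : D → D → Ω
  IsMenger X σ = ∃̇ λ w → Isω w ∧̇
    (∀̇ λ u →
      (IsFunctionOn u w ∧̇
       (∀∈ w λ n → ∀̇ λ 𝒰 → u ⟨ n ⟩↦ 𝒰 ⇒̇ IsOpenCover X σ 𝒰)) ⇒̇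
      (∃̇ λ f →
        IsFunctionOn f w ∧̇
        (∀∈ w λ n → ∀̇ λ 𝒰 → ∀̇ λ F →
          (u ⟨ n ⟩↦ 𝒰 ∧̇ f ⟨ n ⟩↦ F) ⇒̇ (F ⊆̇ 𝒰 ∧̇ IsFinite w F)) ∧̇
        (∀∈ X λ x → ∃∈ w λ n → ∃̇ λ F →
          f ⟨ n ⟩↦ F ∧̇ (∃∈ F λ U → x ∈̇ U))))

inV : Interpretation
inV = record
  { D = V
  ; Ω = Set₁
  ; _∈̇_ = λ x y → Lift _ (x ∈ y)
  ; _≐̇_ = λ x y → Lift _ (x ≐ y)
  ; ⊥̇ = Lift _ ⊥
  ; _∧̇_ = _×_
  ; _∨̇_ = _⊎_
  ; _⇒̇_ = λ φ ψ → φ → ψ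
  ; ∀̇ = λ φ → ∀ x → φ x
  ; ∃̇ = ∃
  }

IsTopologyOn : V → V → Set₁
IsTopologyOn = SetLanguage.IsTopology inV

Menger : V → V → Set₁
Menger = SetLanguage.IsMenger inV

module Forcing (ℙ : Poset 0ℓ 0ℓ 0ℓ) where
  open Poset ℙ using (_≤_) renaming (Carrier to Cond)

  Compatible : Cond → Cond → Set
  Compatible p q = ∃[ r ] r ≤ p × r ≤ q

  DenseBelow : ∀ {ℓ} → Cond → Pred Cond ℓ → Set ℓ
  DenseBelow p φ = ∀ q → q ≤ p → ∃[ r ] r ≤ q × φ r

  -- name I f s is the ℙ-name {(f i , s i) : i ∈ I}.
  data Name : Set₁ where
    name : (I : Set) → (I → Name) → (I → Cond) → Name

  -- x̌ = {(y̌ , p) : y ∈ x , p ∈ ℙ}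
  check : V → Name
  check (sup A f) = name (A × Cond) (λ (a , p) → check (f a)) proj₂

  -- The usual recursion for the forcing relation on atomic formulas: p forces
  -- a = b when every q below p and below s i forces f i ∈ b, and conversely.
  _⊩_≐_ : Cond → Name → Name → Set
  p ⊩ name I f s ≐ name J g t =
    (∀ i q → q ≤ p → q ≤ s i →
       DenseBelow q λ r → ∃[ j ] r ≤ t j × r ⊩ f i ≐ g j) ×
    (∀ j q → q ≤ p → q ≤ t j →
       DenseBelow q λ r → ∃[ i ] r ≤ s i × r ⊩ f i ≐ g j)

  _⊩_∈_ : Cond → Name → Name → Set
  p ⊩ a ∈ name J g t = DenseBelow p λ r → ∃[ j ] r ≤ t j × r ⊩ a ≐ g j

  -- A truth value is identified with the set of conditions forcing it.
  forced : Interpretation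
  forced = record
    { D = Name
    ; Ω = Pred Cond (lsuc 0ℓ)
    ; _∈̇_ = λ a b p → Lift _ (p ⊩ a ∈ b)
    ; _≐̇_ = λ a b p → Lift _ (p ⊩ a ≐ b)
    ; ⊥̇ = λ _ → Lift _ ⊥
    ; _∧̇_ = λ φ ψ p → φ p × ψ p
    ; _∨̇_ = λ φ ψ p → DenseBelow p λ r → φ r ⊎ ψ r
    ; _⇒̇_ = λ φ ψ p → ∀ q → q ≤ p → φ q → ψ q
    ; ∀̇ = λ φ p → ∀ a → φ a p
    ; ∃̇ = λ φ p → DenseBelow p λ r → ∃[ a ] φ a r
    }

  -- σ ranges over names for the topology with basis τ; in the extension there
  -- is exactly one, since τ is closed under finite intersections.
  ForcesMenger : V → V → Set₁
  ForcesMenger X τ = ∀ p → MengerInExtension p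
    where
    open Interpretation forced
    open SetLanguage forced
    MengerInExtension : Ω
    MengerInExtension = ∀̇ λ σ →
      (IsTopology (check X) σ ∧̇ IsBasis (check τ) σ) ⇒̇ IsMenger (check X) σ

-- L is the order relation of the poset, as a set of ordered pairs.
record IsPoset (P L : V) : Set where
  _≤_ : Index P → Index P → Set
  p ≤ q = ⟨ elem P p , elem P q ⟩ ∈ L
  field
    relation       : L ⊆ (P ⊗ P)
    isPartialOrder : IsPartialOrder (Setoid._≈_ (El P)) _≤_

  poset : Poset 0ℓ 0ℓ 0ℓ
  poset = record { isPartialOrder = isPartialOrder }

module StrongProperness {P L : V} (isPoset : IsPoset P L) where
  open IsPoset isPoset using (_≤_; poset)
  open Forcing poset using (Compatible)

  infix 4 _∈ᴾ_
  _∈ᴾ_ : Index P → V → Set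
  p ∈ᴾ M = elem P p ∈ M

  IsResidue : V → Index P → Index P → Set
  IsResidue M q q̄ = q̄ ∈ᴾ M × (∀ s → s ≤ q̄ → s ∈ᴾ M → Compatible s q)

  StronglyGeneric : V → Index P → Set
  StronglyGeneric M p = ∀ q → q ≤ p → ∃[ q̄ ] IsResidue M q q̄

  StronglyProperFor : V → Set
  StronglyProperFor M = ∀ s → s ∈ᴾ M → ∃[ p ] p ≤ s × StronglyGeneric M p

  StronglyProperModel : V → Pred V (lsuc 0ℓ)
  StronglyProperModel θ M =
    IsCountable M × M ≺H θ × ⟨ P , L ⟩ ∈ M × StronglyProperFor M

module Submission where

-- Fix p forcing u to be a sequence of open covers, and let W(n,s) consist of the
-- B ∈ τ such that some r ≤ s forces B to be contained in a member of u(n).  It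
-- covers X when s is compatible with p.  A Menger space is Lindelöf, so countably
-- many r suffice, and the countable M for which all these r may be taken in M
-- contain a club; this replaces the use of elementarity.  Let M be such a model for
-- which ℙ is strongly proper, p̄ ≤ p strongly generic, and (s_k) an enumeration
-- of M ∩ ℙ.  For each k, the Menger property is applied to the covers W(n,s_k),
-- with r ∈ M, for n in the k-th of infinitely many disjoint infinite sets of
-- indices.  This assigns to each n finitely many r ∈ M together with names U_r for
-- members of u(n); in the extension V[G], let F_n be the set of those U_r with
-- r ∈ G.  If q ≤ p̄ has residue s_k, then for every x ∈ X an r ≤ s_k was chosen
-- that forces x ∈ U_r.  Being in M, it is compatible with q, so that q does not force
-- the F_n to miss x.

open import Defs
open import Axiom.ExcludedMiddle using (ExcludedMiddle)
open import Data.Bool.Base using (Bool; true; false; if_then_else_)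
open import Data.Empty using (⊥-elim)
open import Data.Fin.Base using (Fin; zero; suc; toℕ; fromℕ<)
open import Data.Fin.Properties using (toℕ-fromℕ<; toℕ<n; toℕ-injective; pigeonhole)
open import Data.List.Base using (List; []; _∷_; allFin; filter; length; lookup; tabulate)
  renaming (map to List-map)
open import Data.List.Membership.Propositional using () renaming (_∈_ to _∈ˡ_)
open import Data.List.Membership.Propositional.Properties
  using (∈-allFin; ∈-filter⁺; ∈-filter⁻; ∈-lookup)
open import Data.List.Relation.Unary.Any using (Any; here; there; index) renaming (map to Any-map)
open import Data.List.Relation.Unary.Any.Properties using (lookup-index; map⁺; tabulate⁺)
open import Data.Nat.Base using (ℕ; zero; suc; _+_; _<_; z≤n; s≤s)
open import Data.Nat.Induction using (<-wellFounded)
open import Data.Nat.Properties using (m≤n⇒m<n∨m≡n; m<n⇒m<1+n; n<1+n; <-cmp; +-suc; +-identityʳ;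
  suc-injective; ≮⇒≥; ≤-antisym; <⇒≢; m≤n⇒m≤1+n; _<?_; _≟_)
open import Data.Product.Base using (Σ; ∃; ∃-syntax; _×_; _,_; proj₁; proj₂; uncurry)
open import Data.Sum.Base using (_⊎_; inj₁; inj₂; [_,_]′) renaming (map to ⊎-map)
open import Data.Unit.Base using (tt)
open import Function.Base using (_∘_; id)
open import Function.Bundles using (Inverse)
open import Function.Construct.Composition using (injection)
open import Induction.WellFounded using (Acc; acc)
open import Level using (0ℓ; Lift; lift; lower) renaming (suc to lsuc)
open import Relation.Binary.Bundles using (Poset)
open import Relation.Binary.Definitions using (tri<; tri≈; tri>)
open import Relation.Binary.PropositionalEquality.Core using (_≡_; refl; sym; trans; cong; subst)
open import Relation.Nullary.Decidable using (Dec; yes; no; True; toWitness; fromWitness)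
open import Relation.Nullary.Negation.Core using (¬_; contradiction)

-- Sets

refl≐ : ∀ {x} → x ≐ x
refl≐ {x} = ≐-refl x

sym≐ : ∀ {x y} → x ≐ y → y ≐ x
sym≐ {x} {y} = ≐-sym x y

trans≐ : ∀ {x y z} → x ≐ y → y ≐ z → x ≐ z
trans≐ {x} {y} {z} = ≐-trans x y z

≡⇒≐ : ∀ {x y} → x ≡ y → x ≐ y
≡⇒≐ refl = refl≐

∈-congˡ : ∀ {x y} z → x ≐ y → y ∈ z → x ∈ z
∈-congˡ z x≐y (b , y≐b) = b , trans≐ x≐y y≐b

∈-congʳ : ∀ {x} y z → y ≐ z → x ∈ y → x ∈ z
∈-congʳ (sup _ _) (sup _ _) (l , _) (a , x≐a) =
  let b , a≐b = l a in b , trans≐ x≐a a≐b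

elem∈ : ∀ x a → elem x a ∈ x
elem∈ x a = a , refl≐

≐-ext : ∀ x y → (∀ z → z ∈ x → z ∈ y) → (∀ z → z ∈ y → z ∈ x) → x ≐ y
≐-ext (sup A f) (sup B g) l r =
  (λ a → l (f a) (a , refl≐)) ,
  (λ b → let a , e = r (g b) (b , refl≐) in a , sym≐ e)

-- Foundation, by structural recursion: if `x` equals its own element `f a`, then `f a` is in turn
-- an element of itself.
∉-self : ∀ x → ¬ (x ∈ x)
∉-self (sup A f) (a , x≐fa) =
  ∉-self (f a) (∈-congʳ (sup A f) (f a) x≐fa (elem∈ (sup A f) a))

∈-pair⁻ : ∀ {v} x y → v ∈ ｛ x , y ｝ → v ≐ x ⊎ v ≐ y
∈-pair⁻ x y (true  , e) = inj₁ e
∈-pair⁻ x y (false , e) = inj₂ e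

∈-pair⁺ : ∀ {v} x y → v ≐ x ⊎ v ≐ y → v ∈ ｛ x , y ｝
∈-pair⁺ x y (inj₁ e) = true  , e
∈-pair⁺ x y (inj₂ e) = false , e

pair-cong : ∀ {x y x′ y′} → x ≐ x′ → y ≐ y′ → ｛ x , y ｝ ≐ ｛ x′ , y′ ｝
pair-cong e e′ =
  (λ { true → true , e ; false → false , e′ }) ,
  (λ { true → true , e ; false → false , e′ })

⟨⟩-cong : ∀ {x y x′ y′} → x ≐ x′ → y ≐ y′ → ⟨ x , y ⟩ ≐ ⟨ x′ , y′ ⟩
⟨⟩-cong e e′ = pair-cong (pair-cong e e) (pair-cong e e′)

singleton-injective : ∀ x a b → ｛ x , x ｝ ≐ ｛ a , b ｝ → x ≐ a
singleton-injective x a b (_ , r) with r true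
... | true  , e = e
... | false , e = e

⟨⟩-injective : ∀ x y x′ y′ →
  ⟨ x , y ⟩ ≐ ⟨ x′ , y′ ⟩ → x ≐ x′ × y ≐ y′
⟨⟩-injective x y x′ y′ e = x≐x′ , y≐y′
  where
  x≐x′ : x ≐ x′
  x≐x′ with proj₁ e true
  ... | true  , h = singleton-injective x x′ x′ h
  ... | false , h = singleton-injective x x′ y′ h

  second : ∀ x y x′ y′ → ⟨ x , y ⟩ ≐ ⟨ x′ , y′ ⟩ → y ≐ x′ ⊎ y ≐ y′
  second x y x′ y′ (l , _) with l false
  ... | true  , h = inj₁ ([ id , id ]′ (∈-pair⁻ x′ x′ (proj₁ h false)))
  ... | false , h = ∈-pair⁻ x′ y′ (proj₁ h false)

  y≐y′ : y ≐ y′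
  y≐y′ with second x y x′ y′ e
          | second x′ y′ x y (sym≐ {⟨ x , y ⟩} {⟨ x′ , y′ ⟩} e)
  ... | inj₂ h | _      = h
  ... | inj₁ _ | inj₂ h = sym≐ h
  -- The degenerate case: both pairs are singletons of singletons, and the first coordinates link
  -- `y` to `y′`.
  ... | inj₁ h | inj₁ k = trans≐ h (trans≐ (sym≐ x≐x′) (sym≐ k))

∈-numeral⁺ : ∀ {i n} → i < n → numeral i ∈ numeral n
∈-numeral⁺ {i} {suc n} (s≤s i≤n) with m≤n⇒m<n∨m≡n i≤n
... | inj₁ i<n = let a , e = ∈-numeral⁺ i<n in inj₁ a , e
... | inj₂ refl = inj₂ true , refl≐

∈-numeral⁻ : ∀ {x} n → x ∈ numeral n → ∃[ i ] i < n × x ≐ numeral i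
∈-numeral⁻ (suc n) (inj₁ a , e) =
  let i , i<n , e′ = ∈-numeral⁻ n (a , e) in i , m<n⇒m<1+n i<n , e′
∈-numeral⁻ (suc n) (inj₂ true , e)  = n , n<1+n n , e
∈-numeral⁻ (suc n) (inj₂ false , e) = n , n<1+n n , e

numeral-injective : ∀ {m n} → numeral m ≐ numeral n → m ≡ n
numeral-injective {m} {n} e with <-cmp m n
... | tri< m<n _ _ = contradiction
  (∈-congʳ (numeral n) (numeral m) (sym≐ e) (∈-numeral⁺ m<n)) (∉-self (numeral m))
... | tri≈ _ m≡n _ = m≡n
... | tri> _ _ n<m = contradiction
  (∈-congʳ (numeral m) (numeral n) e (∈-numeral⁺ n<m)) (∉-self (numeral n))

-- The vocabulary of set theory evaluated in V

module InV = SetLanguage inV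

≐⇒isPairⱽ : ∀ {z} x y → z ≐ ｛ x , y ｝ → InV.IsPair z x y
≐⇒isPairⱽ {z} x y e w =
  (λ (lift h) → ⊎-map lift lift (∈-pair⁻ x y (∈-congʳ z ｛ x , y ｝ e h))) ,
  (λ h → lift (∈-congʳ ｛ x , y ｝ z (sym≐ {z} e) (∈-pair⁺ x y (⊎-map lower lower h))))

isPair⇒≐ⱽ : ∀ {z} x y → InV.IsPair z x y → z ≐ ｛ x , y ｝
isPair⇒≐ⱽ {z} x y h = ≐-ext z ｛ x , y ｝
  (λ v v∈z → ∈-pair⁺ x y (⊎-map lower lower (proj₁ (h v) (lift v∈z))))
  (λ v v∈p → lower (proj₂ (h v) (⊎-map lift lift (∈-pair⁻ x y v∈p))))

≐⇒isOrderedPairⱽ : ∀ {z} x y → z ≐ ⟨ x , y ⟩ → InV.IsOrderedPair z x y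
≐⇒isOrderedPairⱽ {z} x y e w =
  (λ (lift h) → ⊎-map (≐⇒isPairⱽ x x) (≐⇒isPairⱽ x y)
    (∈-pair⁻ ｛ x , x ｝ ｛ x , y ｝ (∈-congʳ z ⟨ x , y ⟩ e h))) ,
  (λ h → lift (∈-congʳ ⟨ x , y ⟩ z (sym≐ {z} e)
    (∈-pair⁺ ｛ x , x ｝ ｛ x , y ｝ (⊎-map (isPair⇒≐ⱽ x x) (isPair⇒≐ⱽ x y) h))))

isOrderedPair⇒≐ⱽ : ∀ {z} x y → InV.IsOrderedPair z x y → z ≐ ⟨ x , y ⟩
isOrderedPair⇒≐ⱽ {z} x y h = ≐-ext z ⟨ x , y ⟩
  (λ w w∈z → ∈-pair⁺ ｛ x , x ｝ ｛ x , y ｝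
    (⊎-map (isPair⇒≐ⱽ x x) (isPair⇒≐ⱽ x y) (proj₁ (h w) (lift w∈z))))
  (λ w w∈p → lower (proj₂ (h w)
    (⊎-map (≐⇒isPairⱽ x x) (≐⇒isPairⱽ x y) (∈-pair⁻ ｛ x , x ｝ ｛ x , y ｝ w∈p))))

↦-congⱽ : ∀ f {x x′ y} → x ≐ x′ → f InV.⟨ x ⟩↦ y → f InV.⟨ x′ ⟩↦ y
↦-congⱽ f {x} {x′} {y} e (z , z∈f , h) = z , z∈f ,
  ≐⇒isOrderedPairⱽ x′ y
    (trans≐ {z} (isOrderedPair⇒≐ⱽ x y h) (⟨⟩-cong {x} {y} {x′} {y} e refl≐))

∈-∪-singleton⁻ : ∀ {y} x → y ∈ (x ∪ ｛ x , x ｝) → y ∈ x ⊎ y ≐ x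
∈-∪-singleton⁻ x (inj₁ a , e)     = inj₁ (a , e)
∈-∪-singleton⁻ x (inj₂ true , e)  = inj₂ e
∈-∪-singleton⁻ x (inj₂ false , e) = inj₂ e

∈-∪-singleton⁺ : ∀ {y} x → y ∈ x ⊎ y ≐ x → y ∈ (x ∪ ｛ x , x ｝)
∈-∪-singleton⁺ x (inj₁ (a , e)) = inj₁ a , e
∈-∪-singleton⁺ x (inj₂ e)       = inj₂ true , e

ω-inductive : InV.IsInductive ω
ω-inductive =
  (∅ , lift (0 , refl≐ {∅}) , λ _ ()) ,
  λ x (lift (n , x≐n)) → numeral (suc n) , lift (suc n , refl≐ {numeral (suc n)}) ,
    λ y → (λ (lift h) → ⊎-map (lift ∘ ∈-congʳ (numeral n) x (sym≐ x≐n))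
                              (λ e → lift (trans≐ e (sym≐ x≐n)))
                              (∈-∪-singleton⁻ (numeral n) h)) ,
          (λ h → lift (∈-∪-singleton⁺ (numeral n)
                  (⊎-map (∈-congʳ x (numeral n) x≐n ∘ lower) (λ (lift e) → trans≐ e x≐n) h)))

numeral∈inductive : ∀ a → InV.IsInductive a → ∀ n → numeral n ∈ a
numeral∈inductive a ((z , lift z∈a , empty) , _) zero =
  ∈-congˡ a (≐-ext ∅ z (λ _ ()) (λ v v∈z → ⊥-elim (lower (empty v (lift v∈z))))) z∈a
numeral∈inductive a ind@(_ , succ) (suc n)
  with y , lift y∈a , h ← succ (numeral n) (lift (numeral∈inductive a ind n)) =
  ∈-congˡ a (≐-ext (numeral (suc n)) y
    (λ v v∈ → lower (proj₂ (h v) (⊎-map lift lift (∈-∪-singleton⁻ (numeral n) v∈))))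
    (λ v v∈ → ∈-∪-singleton⁺ (numeral n) (⊎-map lower lower (proj₁ (h v) (lift v∈)))))
    y∈a

-- The number `n` provided by finiteness in the language of sets is a numeral, so the function `g`
-- can be read off on `Fin k`. Repetitions in the enumeration do no harm.
finite-enumeration : ∀ {w F} → (∀ {x} → x ∈ w → ∃[ n ] x ≐ numeral n) →
  InV.IsFinite w F →
  ∃[ k ] ∃ λ (y : Fin k → V) → (∀ i → y i ∈ F) × (∀ {U} → U ∈ F → ∃[ i ] U ≐ y i)
finite-enumeration {w} {F} w-numeral (n , lift n∈w , g , (_ , total) , range)
  with k , n≐k ← w-numeral n∈w = k , y , y∈F , surjective
  where
  i∈n : (i : Fin k) → numeral (toℕ i) ∈ n
  i∈n i = ∈-congʳ (numeral k) n (sym≐ n≐k) (∈-numeral⁺ (toℕ<n i))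

  value : (i : Fin k) → ∃ λ y → g InV.⟨ numeral (toℕ i) ⟩↦ y ×
    (∀ y′ → g InV.⟨ numeral (toℕ i) ⟩↦ y′ → Lift (lsuc 0ℓ) (y′ ≐ y))
  value i = total (numeral (toℕ i)) (lift (i∈n i))

  y : Fin k → V
  y = proj₁ ∘ value

  y∈F : ∀ i → y i ∈ F
  y∈F i = lower (proj₂ (range (y i)) (numeral (toℕ i) , lift (i∈n i) , proj₁ (proj₂ (value i))))

  surjective : ∀ {U} → U ∈ F → ∃[ i ] U ≐ y i
  surjective {U} U∈F
    with κ , lift κ∈n , g↦ ← proj₁ (range U) (lift U∈F)
    with i , i<k , κ≐i ← ∈-numeral⁻ k (∈-congʳ n (numeral k) n≐k κ∈n) =
    fromℕ< i<k , lower (proj₂ (proj₂ (value (fromℕ< i<k))) U (↦-congⱽ g (trans≐ κ≐i i≐) g↦))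
    where
    i≐ : numeral i ≐ numeral (toℕ (fromℕ< i<k))
    i≐ = sym≐ (≡⇒≐ (cong numeral (toℕ-fromℕ< i<k)))

graph : (ℕ → V) → V
graph y = sup ℕ λ n → ⟨ numeral n , y n ⟩

graph-↦⁺ : ∀ {x} y n → x ≐ numeral n → graph y InV.⟨ x ⟩↦ y n
graph-↦⁺ {x} y n e = ⟨ numeral n , y n ⟩ , lift (elem∈ (graph y) n) ,
  ≐⇒isOrderedPairⱽ x (y n)
    (⟨⟩-cong {numeral n} {y n} {x} {y n} (sym≐ e) refl≐)

graph-↦⁻ : ∀ {x v} y n → x ≐ numeral n → graph y InV.⟨ x ⟩↦ v → v ≐ y n
graph-↦⁻ {x} {v} y n x≐n (z , lift (m , z≐m) , h)
  with x≐m , v≐m ← ⟨⟩-injective x v (numeral m) (y m)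
         (trans≐ {⟨ x , v ⟩} {z} (sym≐ {z} (isOrderedPair⇒≐ⱽ x v h)) z≐m)
  with refl ← numeral-injective {m} {n} (trans≐ (sym≐ x≐m) x≐n) = v≐m

graph-function : ∀ {w} y → (∀ n → numeral n ∈ w) →
  (∀ {x} → x ∈ w → ∃[ n ] x ≐ numeral n) → InV.IsFunctionOn (graph y) w
graph-function y numeral∈w w-numeral =
  (λ z (lift (n , z≐n)) →
    numeral n , lift (numeral∈w n) , y n , ≐⇒isOrderedPairⱽ (numeral n) (y n) z≐n) ,
  (λ x (lift x∈w) → let n , x≐n = w-numeral x∈w in
    y n , graph-↦⁺ y n x≐n , λ v h → lift (graph-↦⁻ y n x≐n h))

finite-values-enumeration : ∀ {w f} (cover : ℕ → V) → (∀ n → numeral n ∈ w) →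
  (∀ {x} → x ∈ w → ∃[ n ] x ≐ numeral n) → InV.IsFunctionOn f w →
  (∀ n F → f InV.⟨ numeral n ⟩↦ F → F InV.⊆̇ cover n × InV.IsFinite w F) →
  ∃ λ (k : ℕ → ℕ) → ∃ λ (y : ∀ n → Fin (k n) → V) →
    (∀ n i → y n i ∈ cover n) ×
    (∀ {x F U} → x ∈ w → f InV.⟨ x ⟩↦ F → U ∈ F → ∃[ n ] ∃[ i ] U ≐ y n i)
finite-values-enumeration {w} {f} cover numeral∈w w-numeral (_ , total) finite =
  (λ n → proj₁ (enumeration n)) ,
  (λ n → proj₁ (proj₂ (enumeration n))) ,
  (λ n i → lower (proj₁ (finite n (F n) (f↦F n)) (proj₁ (proj₂ (enumeration n)) i)
             (lift (proj₁ (proj₂ (proj₂ (enumeration n))) i)))) ,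
  λ {x} {F′} {U} x∈w f↦F′ U∈F′ → let n , x≐n = w-numeral x∈w in
    n , proj₂ (proj₂ (proj₂ (enumeration n)))
          (∈-congʳ F′ (F n) (unique n F′ (↦-congⱽ f x≐n f↦F′)) U∈F′)
  where
  F : ℕ → V
  F n = proj₁ (total (numeral n) (lift (numeral∈w n)))

  f↦F : ∀ n → f InV.⟨ numeral n ⟩↦ F n
  f↦F n = proj₁ (proj₂ (total (numeral n) (lift (numeral∈w n))))

  unique : ∀ n F′ → f InV.⟨ numeral n ⟩↦ F′ → F′ ≐ F n
  unique n F′ h = lower (proj₂ (proj₂ (total (numeral n) (lift (numeral∈w n)))) F′ h)

  enumeration : ∀ n → ∃[ k ] ∃ λ (y : Fin k → V) →
    (∀ i → y i ∈ F n) × (∀ {U} → U ∈ F n → ∃[ i ] U ≐ y i)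
  enumeration n = finite-enumeration {w} {F n} w-numeral (proj₂ (finite n (F n) (f↦F n)))

-- The Menger property for families given by predicates on the indices of basic sets. The chosen
-- sets come back as lists together with their proofs of `𝒲`, from which conditions and names are
-- extracted later.
menger-selection : (∀ {ℓ} → ExcludedMiddle ℓ) → ∀ {X τ} → Menger X τ →
  (𝒲 : ℕ → Index τ → Set₁) →
  (∀ n x → ∃ λ B → 𝒲 n B × elem X x ∈ elem τ B) →
  Σ (∀ n → List (∃ (𝒲 n))) λ E →
    ∀ x → ∃[ n ] Any (λ (B , _) → elem X x ∈ elem τ B) (E n)
menger-selection em {X} {τ} (w , (w-inductive , w-least) , select) 𝒲 covers =
  let f , f-function , f-finite , f-covers =
        select (graph cover) (graph-function {w} cover numeral∈w w-numeral , graph-covers)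
      k , y , y∈cover , surjective =
        finite-values-enumeration {w} {f} cover numeral∈w w-numeral f-function
          (λ n F f↦F → f-finite (numeral n) (lift (numeral∈w n)) (cover n) F
            (graph-↦⁺ cover n (refl≐ {numeral n}) , f↦F))
  in selection k y y∈cover λ x →
       let v , lift v∈w , F , f↦F , U , lift U∈F , lift x∈U =
             f-covers (elem X x) (lift (elem∈ X x))
           n , i , U≐y = surjective v∈w f↦F U∈F
       in n , i , ∈-congʳ U (y n i) U≐y x∈U
  where
  -- `𝒲 n B` lies in `Set₁`, while a set needs an index type in `Set`. Excluded middle supplies a
  -- small equivalent, `True` of the decision.
  cover : ℕ → V
  cover n = sup (Σ (Index τ) λ B → True (em {P = 𝒲 n B})) (elem τ ∘ proj₁)

  w-numeral : ∀ {x} → x ∈ w → ∃[ n ] x ≐ numeral n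
  w-numeral x∈w = lower (w-least ω ω-inductive _ (lift x∈w))

  numeral∈w : ∀ n → numeral n ∈ w
  numeral∈w = numeral∈inductive w w-inductive

  graph-covers : InV.∀∈ w λ n → ∀ 𝒰 → graph cover InV.⟨ n ⟩↦ 𝒰 → InV.IsOpenCover X τ 𝒰
  graph-covers x (lift x∈w) 𝒰 h
    with n , x≐n ← w-numeral x∈w
    with 𝒰≐ ← graph-↦⁻ cover n x≐n h =
    (λ U (lift U∈𝒰) → let (B , _) , e = ∈-congʳ 𝒰 (cover n) 𝒰≐ U∈𝒰 in lift (B , e)) ,
    (λ y (lift (a , y≐a)) → let B , B∈𝒲 , a∈B = covers n a in
      elem τ B ,
      lift (∈-congʳ (cover n) 𝒰 (sym≐ {𝒰} 𝒰≐) (elem∈ (cover n) (B , fromWitness B∈𝒲))) ,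
      lift (∈-congˡ (elem τ B) y≐a a∈B))

  selection : (k : ℕ → ℕ) (y : ∀ n → Fin (k n) → V) → (∀ n i → y n i ∈ cover n) →
    (∀ x → ∃[ n ] ∃[ i ] elem X x ∈ y n i) →
    Σ (∀ n → List (∃ (𝒲 n))) λ E →
      ∀ x → ∃[ n ] Any (λ (B , _) → elem X x ∈ elem τ B) (E n)
  selection k y y∈cover covers =
    (λ n → tabulate (entry n)) ,
    λ x → let n , i , x∈y = covers x in
      n , tabulate⁺ i (∈-congʳ (y n i) (elem τ (proj₁ (entry n i))) (proj₂ (y∈cover n i)) x∈y)
    where
    entry : ∀ n → Fin (k n) → ∃ (𝒲 n)
    entry n i = let (B , B∈𝒲) , _ = y∈cover n i in B , toWitness B∈𝒲

-- Countable sets and clubs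

⊆⇒≤ᶜ : ∀ x y → x ⊆ y → x ≤ᶜ y
⊆⇒≤ᶜ x y x⊆y = record
  { to = proj₁ ∘ x⊆y
  ; cong = λ {a} {b} e →
      trans≐ (sym≐ {elem x a} (proj₂ (x⊆y a))) (trans≐ {elem x a} e (proj₂ (x⊆y b)))
  ; injective = λ {a} {b} e →
      trans≐ {elem x a} (proj₂ (x⊆y a)) (trans≐ e (sym≐ {elem x b} (proj₂ (x⊆y b))))
  }

H-⊆ : ∀ θ x y → trcl y ⊆ trcl x → H θ x → H θ y
H-⊆ θ x y y⊆x (x≤θ , θ≰x) =
  injection y≤x x≤θ , λ θ≤y → θ≰x (injection θ≤y y≤x)
  where
  y≤x : trcl y ≤ᶜ trcl x
  y≤x = ⊆⇒≤ᶜ (trcl y) (trcl x) y⊆x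

trcl-cong : ∀ x y → x ≐ y → trcl x ⊆ trcl y
trcl-cong (sup A f) (sup B g) (l , _) (a , inj₁ tt) =
  let b , e = l a in (b , inj₁ tt) , e
trcl-cong (sup A f) (sup B g) (l , _) (a , inj₂ t) =
  let b , e = l a
      t′ , e′ = trcl-cong (f a) (g b) e t
  in (b , inj₂ t′) , e′

trcl-elem : ∀ x a → trcl (elem x a) ⊆ trcl x
trcl-elem (sup A f) a t = (a , inj₂ t) , refl≐

H-cong : ∀ θ x y → x ≐ y → H θ x → H θ y
H-cong θ x y e = H-⊆ θ x y (trcl-cong y x (sym≐ {x} e))

H-elem : ∀ θ x a → H θ x → H θ (elem x a)
H-elem θ x a = H-⊆ θ x (elem x a) (trcl-elem x a)

-- A walk along the antidiagonals: down from `(suc a , b)` to `(a , suc b)`, and from the end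
-- `(0 , b)` of one diagonal to the start `(suc b , 0)` of the next.
unpair : ℕ → ℕ × ℕ
unpair zero = 0 , 0
unpair (suc n) with unpair n
... | zero  , b = suc b , 0
... | suc a , b = a , suc b

unpair-surjective : ∀ a b → ∃[ n ] unpair n ≡ (a , b)
unpair-surjective a b = reach (a + b) b a refl
  where
  reach : ∀ s b a → a + b ≡ s → ∃[ n ] unpair n ≡ (a , b)
  reach s (suc b) a e
    with n , h ← reach s b (suc a) (trans (sym (+-suc a b)) e) = suc n , next
    where
    next : unpair (suc n) ≡ (a , suc b)
    next rewrite h = refl
  reach zero zero zero e = 0 , refl
  reach (suc s) zero (suc a) e
    with n , h ← reach s a 0 (trans (sym (+-identityʳ a)) (suc-injective e)) = suc n , next
    where
    next : unpair (suc n) ≡ (suc a , 0)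
    next rewrite h = refl

abstract
  pair : ℕ → ℕ → ℕ
  pair a b = proj₁ (unpair-surjective a b)

  unpair-pair : ∀ a b → unpair (pair a b) ≡ (a , b)
  unpair-pair a b = proj₂ (unpair-surjective a b)

module Countability (em : ∀ {ℓ} → ExcludedMiddle ℓ) where
  open import Data.Nat.Base using (_≤_)
  open import Data.Nat.Properties using (≤-refl; ≤-trans)

  least : ∀ {ℓ} (Q : ℕ → Set ℓ) → ∃ Q → ∃[ n ] Q n × (∀ m → m < n → ¬ Q m)
  least Q (n , q) = go n q (<-wellFounded n)
    where
    go : ∀ n → Q n → Acc _<_ n → ∃[ n ] Q n × (∀ m → m < n → ¬ Q m)
    go n q (acc rs) with em {P = ∃[ m ] m < n × Q m}
    ... | yes (m , m<n , q′) = go m q′ (rs m<n)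
    ... | no ¬q = n , q , λ m m<n q′ → ¬q (m , m<n , q′)

  -- Each element is sent to the number of distinct values listed before its
  -- first occurrence in the enumeration e.
  countable : ∀ x (e : ℕ → V) → (∀ n → e n ∈ x) → (∀ {y} → y ∈ x → ∃[ n ] y ≐ e n) →
    (i : ℕ → V) → (∀ n → i n ∈ x) → (∀ {m n} → i m ≐ i n → m ≡ n) → IsCountable x
  countable x e e∈x surjective i i∈x i-injective = record
    { to = proj₁ ∘ preimage
    ; from = code
    ; to-cong = λ { refl → refl≐ }
    ; from-cong = λ {a} {b} → code-cong a b
    ; inverse =
        (λ { {a} refl → code-injective (proj₁ (preimage (code a))) a (proj₂ (preimage (code a))) }) ,
        (λ {m} {a} h → trans (code-cong a _ h) (proj₂ (preimage m)))
    }
    where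
    New : ℕ → Set
    New k = ∀ j → j < k → ¬ (e j ≐ e k)

    add : ∀ {k} → Dec (New k) → ℕ → ℕ
    add (yes _) n = suc n
    add (no _)  n = n

    count : ℕ → ℕ
    count zero = 0
    count (suc k) = add (em {P = New k}) (count k)

    count-step : ∀ k → count k ≤ count (suc k)
    count-step k with em {P = New k}
    ... | yes _ = m≤n⇒m≤1+n ≤-refl
    ... | no _ = ≤-refl

    count-new : ∀ k → New k → count (suc k) ≡ suc (count k)
    count-new k new with em {P = New k}
    ... | yes _ = refl
    ... | no ¬new = contradiction new ¬new

    count-mono : ∀ {j} k → j ≤ k → count j ≤ count k
    count-mono zero z≤n = ≤-refl
    count-mono {j} (suc k) j≤k with m≤n⇒m<n∨m≡n j≤k
    ... | inj₁ (s≤s j≤k′) = ≤-trans (count-mono k j≤k′) (count-step k)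
    ... | inj₂ refl = ≤-refl

    count-strict : ∀ {j k} → New j → j < k → count j < count k
    count-strict {j} {k} new j<k =
      subst (_≤ count k) (count-new j new) (count-mono k j<k)

    -- A discrete intermediate value argument: `count` rises by at most one at each step, and only
    -- at new positions, so it passes `m` at one of them.
    count-value : ∀ {m} K → m < count K → ∃[ k ] New k × count k ≡ m
    count-value {m} (suc K) m<c with em {P = New K} | m <? count K
    ... | _       | yes m<c′ = count-value K m<c′
    ... | no _    | no m≮c   = contradiction m<c m≮c
    count-value {m} (suc K) (s≤s m≤c) | yes new | no m≮c =
      K , new , ≤-antisym (≮⇒≥ m≮c) m≤c

    first : ∀ a → ∃[ n ] elem x a ≐ e n × (∀ m → m < n → ¬ (elem x a ≐ e m))
    first a = least (λ n → elem x a ≐ e n) (surjective (elem∈ x a))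

    new-first : ∀ a → New (proj₁ (first a))
    new-first a j j<n h =
      proj₂ (proj₂ (first a)) j j<n (trans≐ (proj₁ (proj₂ (first a))) (sym≐ h))

    code : Index x → ℕ
    code a = count (proj₁ (first a))

    code-injective : ∀ a b → code a ≡ code b → elem x a ≐ elem x b
    code-injective a b h with <-cmp (proj₁ (first a)) (proj₁ (first b))
    ... | tri< lt _ _ = contradiction h (<⇒≢ (count-strict (new-first a) lt))
    ... | tri> _ _ gt = contradiction (sym h) (<⇒≢ (count-strict (new-first b) gt))
    ... | tri≈ _ eq _ = trans≐ (proj₁ (proj₂ (first a)))
      (subst (λ n → e n ≐ elem x b) (sym eq) (sym≐ (proj₁ (proj₂ (first b)))))

    code-cong : ∀ a b → elem x a ≐ elem x b → code a ≡ code b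
    code-cong a b h with <-cmp (proj₁ (first a)) (proj₁ (first b))
    ... | tri< lt _ _ = contradiction (trans≐ (sym≐ h) (proj₁ (proj₂ (first a))))
                          (proj₂ (proj₂ (first b)) _ lt)
    ... | tri> _ _ gt = contradiction (trans≐ h (proj₁ (proj₂ (first b))))
                          (proj₂ (proj₂ (first a)) _ gt)
    ... | tri≈ _ eq _ = cong count eq

    i-code : ℕ → ℕ
    i-code n = code (proj₁ (i∈x n))

    i-code-injective : ∀ {m n} → i-code m ≡ i-code n → m ≡ n
    i-code-injective {m} {n} h = i-injective
      (trans≐ (proj₂ (i∈x m)) (trans≐ (code-injective _ _ h) (sym≐ (proj₂ (i∈x n)))))

    -- Here infinitude enters: otherwise the first `suc m` values of the injection `i` would have
    -- distinct codes below `m`.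
    unbounded : ∀ m → ∃[ n ] m ≤ i-code n
    unbounded m with em {P = ∃[ n ] m ≤ i-code n}
    ... | yes h = h
    ... | no ¬h =
      let j , k , j<k , eq = pigeonhole (n<1+n m) (λ n → fromℕ< (bounded n))
      in contradiction
           (i-code-injective (trans (sym (toℕ-fromℕ< (bounded j)))
             (trans (cong toℕ eq) (toℕ-fromℕ< (bounded k)))))
           (<⇒≢ j<k)
      where
      bounded : (n : Fin (suc m)) → i-code (toℕ n) < m
      bounded n with i-code (toℕ n) <? m
      ... | yes lt = lt
      ... | no ≮ = contradiction (toℕ n , ≮⇒≥ ≮) ¬h

    code-new : ∀ {k} a → New k → elem x a ≐ e k → code a ≡ count k
    code-new {k} a new h with <-cmp (proj₁ (first a)) k
    ... | tri< lt _ _ = contradiction (trans≐ (sym≐ (proj₁ (proj₂ (first a)))) h) (new _ lt)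
    ... | tri> _ _ gt = contradiction h (proj₂ (proj₂ (first a)) _ gt)
    ... | tri≈ _ eq _ = cong count eq

    preimage : ∀ m → ∃[ a ] code a ≡ m
    preimage m =
      let n , m≤ = unbounded m
          a = proj₁ (i∈x n)
          k = proj₁ (first a)
          -- The first occurrence `k` is new, so `count (suc k)` is one more than the code of `a`
          -- and thus exceeds `m`.
          k′ , new , h = count-value (suc k)
            (subst (m <_) (sym (count-new k (new-first a))) (s≤s m≤))
          b , e≐b = e∈x k′
      in b , trans (code-new b new (sym≐ e≐b)) h

  enumerate : ∀ {x} → IsCountable x →
    ∃ λ (e : ℕ → Index x) → (∀ {y} → y ∈ x → ∃[ n ] y ≐ elem x (e n)) ×
      (∀ {m n} → elem x (e m) ≐ elem x (e n) → m ≡ n)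
  enumerate c = to ,
    (λ (a , y≐a) → from a , trans≐ y≐a (sym≐ (strictlyInverseˡ a))) ,
    (λ {m} {n} h → trans (sym (strictlyInverseʳ m)) (trans (from-cong h) (strictlyInverseʳ n)))
    where open Inverse c

  -- `IsCountable` means countably infinite. The injection from ℕ that `countable` asks for is
  -- inherited from the subset `x`.
  countable-⊇ : ∀ {x} y → IsCountable x → x ⊆ y →
    (e : ℕ → V) → (∀ n → e n ∈ y) → (∀ {z} → z ∈ y → ∃[ n ] z ≐ e n) → IsCountable y
  countable-⊇ {x} y c x⊆y e e∈y surjective =
    let i , _ , i-injective = enumerate {x} c in
    countable y e e∈y surjective (λ n → elem x (i n)) (λ n → x⊆y (i n)) i-injective

  countable-cong : ∀ x y → x ≐ y → IsCountable x → IsCountable y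
  countable-cong x y x≐y c =
    let e , surjective , _ = enumerate {x} c in
    countable-⊇ {x} y c (λ a → ∈-congʳ x y x≐y (elem∈ x a))
      (λ n → elem x (e n)) (λ n → ∈-congʳ x y x≐y (elem∈ x (e n)))
      (λ {z} z∈y → surjective (∈-congʳ y x (sym≐ {x} x≐y) z∈y))

  -- `F` need not respect `≐`, whereas a club must. Closure is therefore asked only for some
  -- representative of each element.
  ClosedUnder : (V → ℕ → V) → V → Set₁
  ClosedUnder F M = ∀ x → x ∈ M → ∃ λ x′ → x ≐ x′ × (∀ k → F x′ k ∈ M)

  closedUnder-club : ∀ {θ z} (F : V → ℕ → V) → H θ z → (∀ x k → H θ x → H θ (F x k)) →
    IsClub θ (λ M → [H θ ]^ℵ₀ M × z ∈ M × ClosedUnder F M)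
  closedUnder-club {θ} {z} F z∈H F∈H = record
    { respects = λ {M} {M′} M≐M′ ((M∈H , c) , z∈M , closed) →
        ((λ a → let b , e = ∈-congʳ M′ M (sym≐ {M} M≐M′) (elem∈ M′ a) in
                H-cong θ (elem M b) (elem M′ a) (sym≐ {elem M′ a} e) (M∈H b)) ,
         countable-cong M M′ M≐M′ c) ,
        ∈-congʳ M M′ M≐M′ z∈M ,
        λ x x∈M′ → let x′ , x≐x′ , F∈M = closed x (∈-congʳ M′ M (sym≐ {M} M≐M′) x∈M′) in
          x′ , x≐x′ , λ k → ∈-congʳ M M′ M≐M′ (F∈M k)
    ; subset = λ _ → proj₁
    ; unbounded = closure
    ; closed = union
    }
    where
    module Closure (M : V) (M∈H : ∀ a → H θ (elem M a)) (c : IsCountable M) where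
      e : ℕ → Index M
      e = proj₁ (enumerate {M} c)

      -- Row 0 lists `z` and the elements of `M`; row `suc j` lists all values of `F` on row `j`,
      -- the position being unpaired into the two arguments. After ω rows the set `N` of all entries
      -- is closed, with the entries themselves as representatives.
      stage : ℕ → ℕ → V
      stage zero zero = z
      stage zero (suc n) = elem M (e n)
      stage (suc j) n = let a , b = unpair n in F (stage j a) b

      stage∈H : ∀ j n → H θ (stage j n)
      stage∈H zero zero = z∈H
      stage∈H zero (suc n) = M∈H (e n)
      stage∈H (suc j) n = F∈H _ _ (stage∈H j _)

      N : V
      N = sup (ℕ × ℕ) (uncurry stage)

      M⊆N : M ⊆ N
      M⊆N a = let n , h = proj₁ (proj₂ (enumerate {M} c)) (elem∈ M a) in (0 , suc n) , h

      list : ℕ → V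
      list n = uncurry stage (unpair n)

      N-countable : IsCountable N
      N-countable = countable-⊇ {M} N c M⊆N list (λ n → elem∈ N (unpair n))
        λ {y} ((j , n) , h) → let m , eq = unpair-surjective j n in
          m , trans≐ {y} h (≡⇒≐ (cong (uncurry stage) (sym eq)))

      N-closed : ClosedUnder F N
      N-closed x ((j , a) , x≐) = stage j a , x≐ , λ b →
        let n , eq = unpair-surjective a b in
        (suc j , n) , ≡⇒≐ (cong (λ (a , b) → F (stage j a) b) (sym eq))

    closure : ∀ M → [H θ ]^ℵ₀ M →
      ∃[ N ] ([H θ ]^ℵ₀ N × z ∈ N × ClosedUnder F N) × M ⊆ N
    closure M (M∈H , c) =
      N , (((λ (j , n) → stage∈H j n) , N-countable) , ((0 , 0) , refl≐) , N-closed) , M⊆N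
      where open Closure M M∈H c

    union : ∀ N → (∀ n → [H θ ]^ℵ₀ (N n) × z ∈ N n × ClosedUnder F (N n)) →
      (∀ n → N n ⊆ N (suc n)) → [H θ ]^ℵ₀ (⋃ N) × z ∈ ⋃ N × ClosedUnder F (⋃ N)
    union N h _ =
      ((λ (n , a) → proj₁ (proj₁ (h n)) a) ,
       countable-⊇ {N 0} (⋃ N) (proj₂ (proj₁ (h 0))) (λ a → (0 , a) , refl≐)
         list list∈ list-surjective) ,
      ∈⋃ 0 (proj₁ (proj₂ (h 0))) ,
      λ x ((n , a) , x≐a) →
        let x′ , x≐x′ , F∈N = proj₂ (proj₂ (h n)) x (a , x≐a) in
        x′ , x≐x′ , λ k → ∈⋃ n (F∈N k)
      where
      ∈⋃ : ∀ {y} n → y ∈ N n → y ∈ ⋃ N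
      ∈⋃ n (a , y≐a) = (n , a) , y≐a

      e : ∀ n → ℕ → Index (N n)
      e n = proj₁ (enumerate {N n} (proj₂ (proj₁ (h n))))

      entry : ℕ × ℕ → V
      entry (n , m) = elem (N n) (e n m)

      list : ℕ → V
      list k = entry (unpair k)

      list∈ : ∀ k → list k ∈ ⋃ N
      list∈ k = let n , m = unpair k in (n , e n m) , refl≐

      list-surjective : ∀ {y} → y ∈ ⋃ N → ∃[ k ] y ≐ list k
      list-surjective {y} ((n , a) , y≐a) =
        let m , h′ = proj₁ (proj₂ (enumerate {N n} (proj₂ (proj₁ (h n))))) (a , y≐a)
            k , eq = unpair-surjective n m
        in k , trans≐ {y} h′ (≡⇒≐ (cong entry (sym eq)))

-- Names and the forcing relation

module ForcingProperties (ℙ : Poset 0ℓ 0ℓ 0ℓ) where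
  open Poset ℙ using (_≤_) renaming (Carrier to Cond; refl to ≤-refl; trans to ≤-trans)
  open Forcing ℙ
  open SetLanguage forced

  dense-map : ∀ {a b} {p} {φ : Cond → Set a} {ψ : Cond → Set b} →
    DenseBelow p φ → (∀ r → r ≤ p → φ r → ψ r) → DenseBelow p ψ
  dense-map d h q q≤p = let r , r≤q , x = d q q≤p in r , r≤q , h r (≤-trans r≤q q≤p) x

  dense-bind : ∀ {a b} {p} {φ : Cond → Set a} {ψ : Cond → Set b} →
    DenseBelow p φ → (∀ r → r ≤ p → φ r → DenseBelow r ψ) → DenseBelow p ψ
  dense-bind d h q q≤p =
    let r , r≤q , x = d q q≤p
        r′ , r′≤r , y = h r (≤-trans r≤q q≤p) x r ≤-refl
    in r′ , ≤-trans r′≤r r≤q , y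

  dense-return : ∀ {a} {p} {φ : Cond → Set a} → (∀ q → q ≤ p → φ q) → DenseBelow p φ
  dense-return h q q≤p = q , ≤-refl , h q q≤p

  dense-mono : ∀ {a} {p q} {φ : Cond → Set a} → q ≤ p → DenseBelow p φ → DenseBelow q φ
  dense-mono q≤p d r r≤q = d r (≤-trans r≤q q≤p)

  ⊩≐-mono : ∀ {p q} a b → q ≤ p → p ⊩ a ≐ b → q ⊩ a ≐ b
  ⊩≐-mono (name _ _ _) (name _ _ _) q≤p (l , r) =
    (λ i q′ q′≤q → l i q′ (≤-trans q′≤q q≤p)) ,
    (λ j q′ q′≤q → r j q′ (≤-trans q′≤q q≤p))

  -- Both clauses of the forcing relation ask only for dense sets, and density below densely many
  -- conditions is density. This is how a case distinction made below `p` yields an equality forced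
  -- by `p`.
  ⊩≐-dense : ∀ {p} a b → DenseBelow p (_⊩ a ≐ b) → p ⊩ a ≐ b
  ⊩≐-dense (name _ _ _) (name _ _ _) d =
    (λ i q q≤p q≤s → dense-bind (dense-mono q≤p d)
      λ r r≤q (l , _) → l i r ≤-refl (≤-trans r≤q q≤s)) ,
    (λ j q q≤p q≤t → dense-bind (dense-mono q≤p d)
      λ r r≤q (_ , h) → h j r ≤-refl (≤-trans r≤q q≤t))

  ⊩≐-refl : ∀ {p} a → p ⊩ a ≐ a
  ⊩≐-refl (name I f s) =
    (λ i q _ q≤s → dense-return λ r r≤q → i , ≤-trans r≤q q≤s , ⊩≐-refl (f i)) ,
    (λ i q _ q≤s → dense-return λ r r≤q → i , ≤-trans r≤q q≤s , ⊩≐-refl (f i))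

  ⊩≐-sym : ∀ {p} a b → p ⊩ a ≐ b → p ⊩ b ≐ a
  ⊩≐-sym (name I f s) (name J g t) (l , r) =
    (λ j q q≤p q≤t → dense-map (r j q q≤p q≤t)
      λ _ _ (i , ≤s , e) → i , ≤s , ⊩≐-sym (f i) (g j) e) ,
    (λ i q q≤p q≤s → dense-map (l i q q≤p q≤s)
      λ _ _ (j , ≤t , e) → j , ≤t , ⊩≐-sym (f i) (g j) e)

  ⊩≐-trans : ∀ {p} a b c → p ⊩ a ≐ b → p ⊩ b ≐ c → p ⊩ a ≐ c
  ⊩≐-trans (name I f s) (name J g t) (name K h u) (l , r) (l′ , r′) =
    (λ i q q≤p q≤s → dense-bind (l i q q≤p q≤s) λ q′ q′≤q (j , ≤t , e) →
      dense-map (l′ j q′ (≤-trans q′≤q q≤p) ≤t) λ q″ q″≤q′ (k , ≤u , e′) →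
        k , ≤u , ⊩≐-trans (f i) (g j) (h k) (⊩≐-mono (f i) (g j) q″≤q′ e) e′) ,
    (λ k q q≤p q≤u → dense-bind (r′ k q q≤p q≤u) λ q′ q′≤q (j , ≤t , e′) →
      dense-map (r j q′ (≤-trans q′≤q q≤p) ≤t) λ q″ q″≤q′ (i , ≤s , e) →
        i , ≤s , ⊩≐-trans (f i) (g j) (h k) e (⊩≐-mono (g j) (h k) q″≤q′ e′))

  ⊩∈-mono : ∀ {p q} a b → q ≤ p → p ⊩ a ∈ b → q ⊩ a ∈ b
  ⊩∈-mono a (name _ _ _) = dense-mono

  ⊩∈-dense : ∀ {p} a b → DenseBelow p (_⊩ a ∈ b) → p ⊩ a ∈ b
  ⊩∈-dense a (name _ _ _) d = dense-bind d λ _ _ h → h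

  ⊩∈-congˡ : ∀ {p} a b c → p ⊩ a ≐ b → p ⊩ b ∈ c → p ⊩ a ∈ c
  ⊩∈-congˡ a b (name K h u) e d = dense-map d λ r r≤p (k , ≤u , e′) →
    k , ≤u , ⊩≐-trans a b (h k) (⊩≐-mono a b r≤p e) e′

  ⊩∈-congʳ : ∀ {p} a b c → p ⊩ b ≐ c → p ⊩ a ∈ b → p ⊩ a ∈ c
  ⊩∈-congʳ a (name J g t) (name K h u) (l , _) d = dense-bind d λ r r≤p (j , ≤t , e) →
    dense-map (l j r r≤p ≤t) λ r′ r′≤r (k , ≤u , e′) →
      k , ≤u , ⊩≐-trans a (g j) (h k) (⊩≐-mono a (g j) r′≤r e) e′

  ⊩∈-name : ∀ {p I f s} i → p ≤ s i → p ⊩ f i ∈ name I f s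
  ⊩∈-name {f = f} i p≤s = dense-return λ q q≤p → i , ≤-trans q≤p p≤s , ⊩≐-refl (f i)

  ⊩-ext : ∀ {p} a b →
    (∀ v q → q ≤ p → q ⊩ v ∈ a → q ⊩ v ∈ b) →
    (∀ v q → q ≤ p → q ⊩ v ∈ b → q ⊩ v ∈ a) → p ⊩ a ≐ b
  ⊩-ext (name I f s) (name J g t) l r =
    (λ i q q≤p q≤s → l (f i) q q≤p (⊩∈-name {f = f} {s} i q≤s)) ,
    (λ j q q≤p q≤t → dense-map (r (g j) q q≤p (⊩∈-name {f = g} {t} j q≤t))
      λ _ _ (i , ≤s , e) → i , ≤s , ⊩≐-sym (g j) (f i) e)

  check-∈⁻ : ∀ {p a} x → p ⊩ a ∈ check x →
    DenseBelow p λ r → ∃[ i ] r ⊩ a ≐ check (elem x i)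
  check-∈⁻ (sup A f) d = dense-map d λ _ _ ((i , _) , _ , e) → i , e

  check-≐⁺ : ∀ {p} x y → x ≐ y → p ⊩ check x ≐ check y
  check-≐⁺ (sup A f) (sup B g) (l , r) =
    (λ (a , _) q q≤p _ → dense-return λ q′ _ → let b , e = l a in
      (b , q′) , ≤-refl , check-≐⁺ (f a) (g b) e) ,
    (λ (b , _) q q≤p _ → dense-return λ q′ _ → let a , e = r b in
      (a , q′) , ≤-refl , check-≐⁺ (f a) (g b) e)

  check-∈⁺ : ∀ {p} x y → x ∈ y → p ⊩ check x ∈ check y
  check-∈⁺ x (sup B g) (b , e) = dense-return λ q _ → (b , q) , ≤-refl , check-≐⁺ x (g b) e

  -- The recursion moves to stronger conditions, which is harmless because the conclusion speaks of
  -- V alone.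
  check-≐⁻ : ∀ {p} x y → p ⊩ check x ≐ check y → x ≐ y
  check-≐⁻ {p} (sup A f) (sup B g) (l , r) =
    (λ a → let _ , _ , (b , _) , _ , e = l (a , p) p ≤-refl ≤-refl p ≤-refl
           in b , check-≐⁻ (f a) (g b) e) ,
    (λ b → let _ , _ , (a , _) , _ , e = r (b , p) p ≤-refl ≤-refl p ≤-refl
           in a , check-≐⁻ (f a) (g b) e)

  check-∈ : ∀ {p} x y → p ⊩ check x ∈ check y → x ∈ y
  check-∈ x y h = let _ , _ , b , e = check-∈⁻ y h _ ≤-refl in b , check-≐⁻ x (elem y b) e

  -- Both members are paired with every condition, as in `check`, because the poset need not have a
  -- largest element.
  pairᴺ : Name → Name → Name
  pairᴺ a b = name (Bool × Cond) (λ (t , _) → if t then a else b) proj₂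

  opairᴺ : Name → Name → Name
  opairᴺ a b = pairᴺ (pairᴺ a a) (pairᴺ a b)

  ∈-pairᴺ⁻ : ∀ {p v} a b → p ⊩ v ∈ pairᴺ a b → DenseBelow p λ r → r ⊩ v ≐ a ⊎ r ⊩ v ≐ b
  ∈-pairᴺ⁻ a b d = dense-map d λ where
    _ _ ((true  , _) , _ , e) → inj₁ e
    _ _ ((false , _) , _ , e) → inj₂ e

  ∈-pairᴺ⁺ : ∀ {p v} a b → (DenseBelow p λ r → r ⊩ v ≐ a ⊎ r ⊩ v ≐ b) → p ⊩ v ∈ pairᴺ a b
  ∈-pairᴺ⁺ a b d = dense-map d λ where
    r _ (inj₁ e) → (true  , r) , ≤-refl , e
    r _ (inj₂ e) → (false , r) , ≤-refl , e

  left∈ : ∀ {p} a b → p ⊩ a ∈ pairᴺ a b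
  left∈ a b = ∈-pairᴺ⁺ a b (dense-return λ _ _ → inj₁ (⊩≐-refl a))

  right∈ : ∀ {p} a b → p ⊩ b ∈ pairᴺ a b
  right∈ a b = ∈-pairᴺ⁺ a b (dense-return λ _ _ → inj₂ (⊩≐-refl b))

  ≐⇒isPair : ∀ {p} z x y → p ⊩ z ≐ pairᴺ x y → IsPair z x y p
  ≐⇒isPair z x y e v =
    (λ q q≤p (lift h) → dense-map
      (∈-pairᴺ⁻ x y (⊩∈-congʳ v z (pairᴺ x y) (⊩≐-mono z (pairᴺ x y) q≤p e) h))
      λ _ _ → ⊎-map lift lift) ,
    (λ q q≤p h → lift (⊩∈-congʳ v (pairᴺ x y) z
      (⊩≐-sym z (pairᴺ x y) (⊩≐-mono z (pairᴺ x y) q≤p e))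
      (∈-pairᴺ⁺ x y (dense-map h λ _ _ → ⊎-map lower lower))))

  isPair⇒≐ : ∀ {p} z x y → IsPair z x y p → p ⊩ z ≐ pairᴺ x y
  isPair⇒≐ z x y h = ⊩-ext z (pairᴺ x y)
    (λ v q q≤p v∈z → ∈-pairᴺ⁺ x y
      (dense-map (proj₁ (h v) q q≤p (lift v∈z)) λ _ _ → ⊎-map lower lower))
    (λ v q q≤p v∈p → lower (proj₂ (h v) q q≤p
      (dense-map (∈-pairᴺ⁻ x y v∈p) λ _ _ → ⊎-map lift lift)))

  ≐⇒isOrderedPair : ∀ {p} z x y → p ⊩ z ≐ opairᴺ x y → IsOrderedPair z x y p
  ≐⇒isOrderedPair z x y e w =
    (λ q q≤p (lift h) → dense-map
      (∈-pairᴺ⁻ (pairᴺ x x) (pairᴺ x y)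
        (⊩∈-congʳ w z (opairᴺ x y) (⊩≐-mono z (opairᴺ x y) q≤p e) h))
      λ _ _ → ⊎-map (≐⇒isPair w x x) (≐⇒isPair w x y)) ,
    (λ q q≤p h → lift (⊩∈-congʳ w (opairᴺ x y) z
      (⊩≐-sym z (opairᴺ x y) (⊩≐-mono z (opairᴺ x y) q≤p e))
      (∈-pairᴺ⁺ (pairᴺ x x) (pairᴺ x y)
        (dense-map h λ _ _ → ⊎-map (isPair⇒≐ w x x) (isPair⇒≐ w x y)))))

  isOrderedPair⇒≐ : ∀ {p} z x y → IsOrderedPair z x y p → p ⊩ z ≐ opairᴺ x y
  isOrderedPair⇒≐ z x y h = ⊩-ext z (opairᴺ x y)
    (λ w q q≤p w∈z → ∈-pairᴺ⁺ (pairᴺ x x) (pairᴺ x y)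
      (dense-map (proj₁ (h w) q q≤p (lift w∈z))
        λ _ _ → ⊎-map (isPair⇒≐ w x x) (isPair⇒≐ w x y)))
    (λ w q q≤p w∈p → lower (proj₂ (h w) q q≤p
      (dense-map (∈-pairᴺ⁻ (pairᴺ x x) (pairᴺ x y) w∈p)
        λ _ _ → ⊎-map (≐⇒isPair w x x) (≐⇒isPair w x y))))

  pairᴺ-cong : ∀ {p} a b a′ b′ → p ⊩ a ≐ a′ → p ⊩ b ≐ b′ → p ⊩ pairᴺ a b ≐ pairᴺ a′ b′
  pairᴺ-cong a b a′ b′ e e′ =
    (λ { (true  , _) q q≤p _ → dense-return λ r r≤q →
           (true , r) , ≤-refl , ⊩≐-mono a a′ (≤-trans r≤q q≤p) e
       ; (false , _) q q≤p _ → dense-return λ r r≤q →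
           (false , r) , ≤-refl , ⊩≐-mono b b′ (≤-trans r≤q q≤p) e′ }) ,
    (λ { (true  , _) q q≤p _ → dense-return λ r r≤q →
           (true , r) , ≤-refl , ⊩≐-mono a a′ (≤-trans r≤q q≤p) e
       ; (false , _) q q≤p _ → dense-return λ r r≤q →
           (false , r) , ≤-refl , ⊩≐-mono b b′ (≤-trans r≤q q≤p) e′ })

  opairᴺ-cong : ∀ {p} a b a′ b′ → p ⊩ a ≐ a′ → p ⊩ b ≐ b′ → p ⊩ opairᴺ a b ≐ opairᴺ a′ b′
  opairᴺ-cong a b a′ b′ e e′ =
    pairᴺ-cong (pairᴺ a a) (pairᴺ a b) (pairᴺ a′ a′) (pairᴺ a′ b′)
      (pairᴺ-cong a a a′ a′ e e) (pairᴺ-cong a b a′ b′ e e′)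

  singletonᴺ-injective : ∀ {p} x a b → p ⊩ pairᴺ x x ≐ pairᴺ a b → p ⊩ x ≐ a
  singletonᴺ-injective x a b e = ⊩≐-dense x a (dense-map
    (∈-pairᴺ⁻ x x (⊩∈-congʳ a (pairᴺ a b) (pairᴺ x x)
      (⊩≐-sym (pairᴺ x x) (pairᴺ a b) e) (left∈ a b)))
    λ _ _ → [ ⊩≐-sym a x , ⊩≐-sym a x ]′)

  -- The argument for `⟨⟩-injective`, except that the disjunctions are decided only densely and the
  -- resulting equalities are brought back to `p` by `⊩≐-dense`.
  opairᴺ-injective : ∀ {p} x y x′ y′ → p ⊩ opairᴺ x y ≐ opairᴺ x′ y′ →
    p ⊩ x ≐ x′ × p ⊩ y ≐ y′
  opairᴺ-injective {p} x y x′ y′ e = x≐x′ , y≐y′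
    where
    x≐x′ : p ⊩ x ≐ x′
    x≐x′ = ⊩≐-dense x x′ (dense-map
      (∈-pairᴺ⁻ (pairᴺ x′ x′) (pairᴺ x′ y′)
        (⊩∈-congʳ (pairᴺ x x) (opairᴺ x y) (opairᴺ x′ y′) e (left∈ (pairᴺ x x) (pairᴺ x y))))
      λ _ _ → [ singletonᴺ-injective x x′ x′ , singletonᴺ-injective x x′ y′ ]′)

    second : ∀ x y x′ y′ → p ⊩ opairᴺ x y ≐ opairᴺ x′ y′ →
      DenseBelow p λ r → r ⊩ y ≐ x′ ⊎ r ⊩ y ≐ y′
    second x y x′ y′ e = dense-bind
      (∈-pairᴺ⁻ (pairᴺ x′ x′) (pairᴺ x′ y′)
        (⊩∈-congʳ (pairᴺ x y) (opairᴺ x y) (opairᴺ x′ y′) e (right∈ (pairᴺ x x) (pairᴺ x y))))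
      λ where
        _ _ (inj₁ h) → dense-map
          (∈-pairᴺ⁻ x′ x′ (⊩∈-congʳ y (pairᴺ x y) (pairᴺ x′ x′) h (right∈ x y)))
          λ _ _ → inj₁ ∘ [ id , id ]′
        _ _ (inj₂ h) → ∈-pairᴺ⁻ x′ y′ (⊩∈-congʳ y (pairᴺ x y) (pairᴺ x′ y′) h (right∈ x y))

    y≐y′ : p ⊩ y ≐ y′
    y≐y′ = ⊩≐-dense y y′ (dense-bind (second x y x′ y′ e) λ where
      r r≤p (inj₂ h) → dense-return λ q q≤r → ⊩≐-mono y y′ q≤r h
      r r≤p (inj₁ h) → dense-map
        (dense-mono r≤p (second x′ y′ x y (⊩≐-sym (opairᴺ x y) (opairᴺ x′ y′) e)))
        λ where
          _ _ (inj₂ k) → ⊩≐-sym y′ y k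
          q q≤r (inj₁ k) → ⊩≐-trans y x′ y′ (⊩≐-mono y x′ q≤r h)
            (⊩≐-trans x′ x y′ (⊩≐-sym x x′ (⊩≐-mono x x′ (≤-trans q≤r r≤p) x≐x′))
              (⊩≐-sym y′ x k)))

  ↦-cong : ∀ {p} f x x′ y → p ⊩ x ≐ x′ → (f ⟨ x ⟩↦ y) p → (f ⟨ x′ ⟩↦ y) p
  ↦-cong f x x′ y e d = dense-map d λ r r≤p (z , z∈f , h) → z , z∈f ,
    ≐⇒isOrderedPair z x′ y (⊩≐-trans z (opairᴺ x y) (opairᴺ x′ y) (isOrderedPair⇒≐ z x y h)
      (opairᴺ-cong x y x′ y (⊩≐-mono x x′ r≤p e) (⊩≐-refl y)))

  ↦-congʳ : ∀ {p} f x y y′ → p ⊩ y ≐ y′ → (f ⟨ x ⟩↦ y′) p → (f ⟨ x ⟩↦ y) p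
  ↦-congʳ f x y y′ e d = dense-map d λ r r≤p (z , z∈f , h) → z , z∈f ,
    ≐⇒isOrderedPair z x y (⊩≐-trans z (opairᴺ x y′) (opairᴺ x y) (isOrderedPair⇒≐ z x y′ h)
      (opairᴺ-cong x y′ x y (⊩≐-refl x) (⊩≐-sym y y′ (⊩≐-mono y y′ r≤p e))))

  module Graph {I : Set} (key : I → V) (value : I → Name) where

    graphᴺ : Name
    graphᴺ = name (I × Cond) (λ (i , _) → opairᴺ (check (key i)) (value i)) proj₂

    graphᴺ-↦⁺ : ∀ {p} x i → p ⊩ x ≐ check (key i) → (graphᴺ ⟨ x ⟩↦ value i) p
    graphᴺ-↦⁺ x i e = dense-return λ q q≤p →
      opairᴺ (check (key i)) (value i) ,
      lift (dense-return λ r _ → (i , r) , ≤-refl , ⊩≐-refl (opairᴺ (check (key i)) (value i))) ,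
      ≐⇒isOrderedPair _ x (value i)
        (opairᴺ-cong (check (key i)) (value i) x (value i)
          (⊩≐-sym x (check (key i)) (⊩≐-mono x (check (key i)) q≤p e)) (⊩≐-refl (value i)))

    graphᴺ-↦⁻ : ∀ {p} x y → (graphᴺ ⟨ x ⟩↦ y) p →
      DenseBelow p λ r → ∃[ i ] r ⊩ x ≐ check (key i) × r ⊩ y ≐ value i
    graphᴺ-↦⁻ x y d = dense-bind d λ r _ (z , lift z∈ , h) →
      dense-map z∈ λ q q≤r ((i , _) , _ , e) →
        i , opairᴺ-injective x y (check (key i)) (value i)
              (⊩≐-trans (opairᴺ x y) z (opairᴺ (check (key i)) (value i))
                (⊩≐-sym z (opairᴺ x y) (⊩≐-mono z (opairᴺ x y) q≤r (isOrderedPair⇒≐ z x y h))) e)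

    -- Values are unique because two keys forced equal are equal already in V, hence belong to the
    -- same index.
    graphᴺ-function : (∀ {i j} → key i ≐ key j → i ≡ j) →
      ∀ D → (∀ i → key i ∈ D) → (∀ {x} → x ∈ D → ∃[ i ] x ≐ key i) →
      ∀ p → IsFunctionOn graphᴺ (check D) p
    graphᴺ-function key-injective D key∈D D-key p =
      (λ z q _ (lift z∈) → dense-map z∈ λ r r≤q ((i , _) , _ , e) →
        check (key i) , lift (check-∈⁺ (key i) D (key∈D i)) ,
        dense-return λ r′ r′≤r → value i ,
          ≐⇒isOrderedPair z (check (key i)) (value i)
            (⊩≐-mono z (opairᴺ (check (key i)) (value i)) r′≤r e)) ,
      (λ x q _ (lift x∈) → dense-map (check-∈⁻ D x∈) λ r r≤q (d , e) →
        let i , d≐i = D-key (elem∈ D d)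
            x≐i = ⊩≐-trans x (check (elem D d)) (check (key i)) e (check-≐⁺ (elem D d) (key i) d≐i)
        in value i , graphᴺ-↦⁺ x i x≐i ,
           λ y r′ r′≤r h → lift (⊩≐-dense y (value i)
             (dense-map (graphᴺ-↦⁻ x y h) λ r″ r″≤r′ (j , x≐j , y≐j) →
               subst (λ k → r″ ⊩ y ≐ value k)
                 (key-injective (check-≐⁻ (key j) (key i)
                   (⊩≐-trans (check (key j)) x (check (key i)) (⊩≐-sym x (check (key j)) x≐j)
                     (⊩≐-mono x (check (key i)) (≤-trans r″≤r′ r′≤r) x≐i))))
                 y≐j)))

  open Graph public

  -- Natural numbers and finite sets in the extension

  ∈-check-suc⁻ : ∀ {p v} n → p ⊩ v ∈ check (numeral (suc n)) →
    DenseBelow p λ r → r ⊩ v ∈ check (numeral n) ⊎ r ⊩ v ≐ check (numeral n)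
  ∈-check-suc⁻ {v = v} n d = dense-map (check-∈⁻ (numeral (suc n)) d) λ where
    _ _ (inj₁ a , e) → inj₁ (⊩∈-congˡ v (check (elem (numeral n) a)) (check (numeral n)) e
                               (check-∈⁺ (elem (numeral n) a) (numeral n) (elem∈ (numeral n) a)))
    _ _ (inj₂ true , e)  → inj₂ e
    _ _ (inj₂ false , e) → inj₂ e

  ∈-check-suc⁺ : ∀ {p v} n →
    (DenseBelow p λ r → r ⊩ v ∈ check (numeral n) ⊎ r ⊩ v ≐ check (numeral n)) →
    p ⊩ v ∈ check (numeral (suc n))
  ∈-check-suc⁺ {v = v} n d = ⊩∈-dense v (check (numeral (suc n))) (dense-bind d λ where
    r _ (inj₁ v∈n) → dense-map (check-∈⁻ (numeral n) v∈n) λ q _ (a , e) →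
      ⊩∈-congˡ v (check (elem (numeral n) a)) (check (numeral (suc n))) e
        (check-∈⁺ (elem (numeral n) a) (numeral (suc n)) (inj₁ a , refl≐))
    r _ (inj₂ e) → dense-return λ q q≤r →
      ⊩∈-congˡ v (check (numeral n)) (check (numeral (suc n))) (⊩≐-mono v (check (numeral n)) q≤r e)
        (check-∈⁺ (numeral n) (numeral (suc n)) (inj₂ true , refl≐)))

  checkω-inductive : ∀ p → IsInductive (check ω) p
  checkω-inductive p =
    (dense-return λ q _ → check ∅ , lift (check-∈⁺ ∅ ω (0 , refl≐ {∅})) ,
      λ x r _ (lift x∈∅) → let _ , _ , (i , _) = check-∈⁻ {a = x} ∅ x∈∅ r ≤-refl in ⊥-elim i) ,
    λ x q _ (lift x∈ω) → dense-map (check-∈⁻ ω x∈ω) λ r _ (n , x≐n) →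
      check (numeral (suc n)) ,
      lift (check-∈⁺ (numeral (suc n)) ω (suc n , refl≐ {numeral (suc n)})) ,
      λ y → (λ r′ r′≤r (lift h) → dense-map (∈-check-suc⁻ n h) λ r″ r″≤r′ →
               let n≐x = ⊩≐-sym x (check (numeral n))
                           (⊩≐-mono x (check (numeral n)) (≤-trans r″≤r′ r′≤r) x≐n) in
               ⊎-map (lift ∘ ⊩∈-congʳ y (check (numeral n)) x n≐x)
                     (λ e → lift (⊩≐-trans y (check (numeral n)) x e n≐x))) ,
            (λ r′ r′≤r h → lift (∈-check-suc⁺ n (dense-map h λ r″ r″≤r′ →
               let x≐n′ = ⊩≐-mono x (check (numeral n)) (≤-trans r″≤r′ r′≤r) x≐n in
               ⊎-map (⊩∈-congʳ y x (check (numeral n)) x≐n′ ∘ lower)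
                     (λ (lift e) → ⊩≐-trans y x (check (numeral n)) e x≐n′))))

  check-numeral∈inductive : ∀ {p} a → IsInductive a p → ∀ n → p ⊩ check (numeral n) ∈ a
  check-numeral∈inductive a (base , _) zero = ⊩∈-dense (check ∅) a
    (dense-map base λ r _ (z , lift z∈a , empty) → ⊩∈-congˡ (check ∅) z a
      (⊩-ext (check ∅) z
        (λ v q _ v∈∅ → let _ , _ , (i , _) = check-∈⁻ {a = v} ∅ v∈∅ q ≤-refl in ⊥-elim i)
        (λ v q q≤r v∈z → ⊥-elim (lower (empty v q q≤r (lift v∈z)))))
      z∈a)
  check-numeral∈inductive {p} a ind@(_ , succ) (suc n) = ⊩∈-dense (check (numeral (suc n))) a
    (dense-map (succ (check (numeral n)) p ≤-refl (lift (check-numeral∈inductive a ind n)))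
      λ r _ (y , lift y∈a , h) → ⊩∈-congˡ (check (numeral (suc n))) y a
        (⊩-ext (check (numeral (suc n))) y
          (λ v q q≤r v∈ → lower (proj₂ (h v) q q≤r
            (dense-map (∈-check-suc⁻ n v∈) λ _ _ → ⊎-map lift lift)))
          (λ v q q≤r v∈ → ∈-check-suc⁺ n
            (dense-map (proj₁ (h v) q q≤r (lift v∈)) λ _ _ → ⊎-map lower lower)))
        y∈a)

  -- A member of `check ω` is densely equal to some `check (numeral n)`, and induction on `n` in V
  -- puts these into every inductive set of the extension.
  checkω-isω : ∀ p → Isω (check ω) p
  checkω-isω p = checkω-inductive p , λ a q _ ind x r r≤q (lift x∈ω) →
    lift (⊩∈-dense x a (dense-map (check-∈⁻ ω x∈ω) λ r′ r′≤r (n , x≐n) →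
      ⊩∈-congˡ x (check (numeral n)) a x≐n
        (⊩∈-mono (check (numeral n)) a (≤-trans r′≤r r≤q) (check-numeral∈inductive a ind n))))

  finite-cong : ∀ {p w} F G → p ⊩ F ≐ G → IsFinite w G p → IsFinite w F p
  finite-cong F G F≐G d = dense-map d λ r r≤p (n , n∈w , d′) →
    n , n∈w , dense-map d′ λ r′ r′≤r (g , g-function , range) →
      let F≐G′ = ⊩≐-mono F G (≤-trans r′≤r r≤p) F≐G in
      g , g-function , λ y →
        (λ q q≤r′ (lift y∈F) →
          proj₁ (range y) q q≤r′ (lift (⊩∈-congʳ y F G (⊩≐-mono F G q≤r′ F≐G′) y∈F))) ,
        (λ q q≤r′ h → lift (⊩∈-congʳ y G F (⊩≐-sym F G (⊩≐-mono F G q≤r′ F≐G′))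
          (lower (proj₂ (range y) q q≤r′ h))))

  module Finite (em : ∀ {ℓ} → ExcludedMiddle ℓ) where

    -- One extension per condition: pass below `s j` if compatible with it, and otherwise stay,
    -- since incompatibility persists to stronger conditions.
    decide-below : ∀ {m} (s : Fin m → Cond) p →
      ∃[ q ] q ≤ p × (∀ j → q ≤ s j ⊎ ¬ Compatible q (s j))
    decide-below {zero} s p = p , ≤-refl , λ ()
    decide-below {suc m} s p
      with q , q≤p , h ← decide-below (s ∘ suc) p
      with em {P = Compatible q (s zero)}
    ... | yes (r , r≤q , r≤s) = r , ≤-trans r≤q q≤p , λ where
      zero → inj₁ r≤s
      (suc j) →
        ⊎-map (≤-trans r≤q) (λ ¬c (t , t≤r , t≤s) → ¬c (t , ≤-trans t≤r r≤q , t≤s)) (h j)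
    ... | no ¬c = q , q≤p , λ where
      zero → inj₂ ¬c
      (suc j) → h j

    -- Below a condition `q` that decides which `s j` are in the generic filter, the name denotes
    -- the set of those `U j` with `q ≤ s j`. Their list `js` lives in V and gives the enumeration.
    finite-name : ∀ {m} (U : Fin m → Name) (s : Fin m → Cond) p →
      IsFinite (check ω) (name (Fin m) U s) p
    finite-name {m} U s p p′ _
      with q , q≤p′ , decided ← decide-below s p′ = q , q≤p′ ,
      check (numeral k) , lift (check-∈⁺ (numeral k) ω (k , refl≐ {numeral k})) ,
      dense-return λ r r≤q → graphᴺ key value ,
        graphᴺ-function key value
          (toℕ-injective ∘ numeral-injective) (numeral k) (λ i → ∈-numeral⁺ (toℕ<n i))
          (λ x∈ → let n , n<k , x≐n = ∈-numeral⁻ k x∈ in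
            fromℕ< n<k , trans≐ x≐n (≡⇒≐ (cong numeral (sym (toℕ-fromℕ< n<k)))))
          r ,
        λ y →
          (λ r₁ r₁≤r (lift y∈F) → dense-map y∈F λ r₂ r₂≤r₁ (j , r₂≤s , y≐j) →
            -- `r₂` is below both `q` and `s j`, so the decision made by `q` about `s j` was
            -- positive.
            let j∈ = selected j (r₂ , ≤-trans r₂≤r₁ (≤-trans r₁≤r r≤q) , r₂≤s)
                i = index j∈
                y≐i = subst (λ j → r₂ ⊩ y ≐ U j) (lookup-index j∈) y≐j
            in check (key i) , lift (check-∈⁺ (key i) (numeral k) (∈-numeral⁺ (toℕ<n i))) ,
               ↦-congʳ (graphᴺ key value) (check (key i)) y (value i) y≐i
                 (graphᴺ-↦⁺ key value (check (key i)) i (⊩≐-refl (check (key i))))) ,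
          (λ r₁ r₁≤r d → lift (dense-bind d λ r₂ r₂≤r₁ (κ , _ , h) →
            dense-map (graphᴺ-↦⁻ key value κ y h) λ r₃ r₃≤r₂ (i , _ , y≐i) →
              lookup js i ,
              ≤-trans (≤-trans r₃≤r₂ (≤-trans r₂≤r₁ (≤-trans r₁≤r r≤q)))
                (proj₂ (∈-filter⁻ (λ j → em {P = q ≤ s j}) {xs = allFin m} (∈-lookup {xs = js} i))) ,
              y≐i))
      where
      js : List (Fin m)
      js = filter (λ j → em {P = q ≤ s j}) (allFin m)

      k : ℕ
      k = length js

      key : Fin k → V
      key = numeral ∘ toℕ

      value : Fin k → Name
      value = U ∘ lookup js

      selected : ∀ j → Compatible q (s j) → j ∈ˡ js
      selected j c with decided j
      ... | inj₁ q≤s = ∈-filter⁺ (λ j → em {P = q ≤ s j}) (∈-allFin j) q≤s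
      ... | inj₂ ¬c = contradiction c ¬c

-- Preservation

nth : ∀ {a} {A : Set a} → A → List A → ℕ → A
nth d [] _ = d
nth d (x ∷ l) zero = x
nth d (x ∷ l) (suc k) = nth d l k

nth-any : ∀ {a q} {A : Set a} {Q : A → Set q} d {l} → Any Q l → ∃[ k ] Q (nth d l k)
nth-any d (here q) = 0 , q
nth-any d (there h) = let k , q = nth-any d h in suc k , q

-- All lists are merged into one sequence by pairing twice. The default `d` fills the positions past
-- the end of a list; only the occurrence of the listed entries is claimed.
flatten : ∀ {a q} {A : Set a} → A → (l : ℕ → ℕ → List A) →
  ∃ λ (ρ : ℕ → A) → ∀ (Q : A → Set q) n j → Any Q (l n j) → ∃[ k ] Q (ρ k)
flatten {q = q} {A} d l = (λ k → entry′ (unpair k)) , covered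
  where
  entry : ℕ × ℕ → ℕ → A
  entry (n , j) = nth d (l n j)

  entry′ : ℕ × ℕ → A
  entry′ (a , i) = entry (unpair a) i

  covered : ∀ (Q : A → Set q) n j → Any Q (l n j) → ∃[ k ] Q (entry′ (unpair k))
  covered Q n j any =
    let i , q = nth-any d any
        a , ea = unpair-surjective n j
        k , ek = unpair-surjective a i
    in k , subst (Q ∘ entry′) (sym ek) (subst (λ nj → Q (entry nj i)) (sym ea) q)

-- The sets of indices `pair k n`, for fixed `k`, are disjoint for different `k`, so `E k` can be
-- prescribed on the `k`-th of them. Comparing `pair k n` with `m` brings the value into the type
-- `T m`; `d` is the default.
reindex : ∀ {a} {T : ℕ → Set a} → (∀ n → T n) → (E : ∀ k n → T (pair k n)) →
  ∃ λ (G : ∀ n → T n) → ∀ k n → G (pair k n) ≡ E k n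
reindex {T = T} d E = (λ m → at m (unpair m)) , λ k n →
  subst (λ kn → at (pair k n) kn ≡ E k n) (sym (unpair-pair k n)) (at-pair k n)
  where
  at : ∀ m → ℕ × ℕ → T m
  at m (k , n) with pair k n ≟ m
  ... | yes refl = E k n
  ... | no _ = d m

  at-pair : ∀ k n → at (pair k n) (k , n) ≡ E k n
  at-pair k n with pair k n ≟ pair k n
  ... | yes refl = refl
  ... | no ≢ = contradiction refl ≢

module Extension (em : ∀ {ℓ} → ExcludedMiddle ℓ) (P : V) (step : Index P → ℕ → Index P) where

  -- Clubs are formed from functions on all of V. Sets outside `P` are left fixed, which keeps them
  -- in `H θ`.
  extend : V → ℕ → V
  extend x k with em {P = x ∈ P}
  ... | yes (s , _) = elem P (step s k)
  ... | no _ = x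

  extend-H : ∀ θ → (∀ s → H θ (elem P s)) → ∀ x k → H θ x → H θ (extend x k)
  extend-H θ P∈H x k x∈H with em {P = x ∈ P}
  ... | yes (s , _) = P∈H (step s k)
  ... | no _ = x∈H

  -- The index that excluded middle finds for `x` may differ from `s`, though both name the same
  -- condition; hence the `s′`.
  extend-elem : ∀ s x → elem P s ≐ x →
    ∃[ s′ ] elem P s ≐ elem P s′ × (∀ k → extend x k ≡ elem P (step s′ k))
  extend-elem s x s≐x with em {P = x ∈ P}
  ... | yes (s′ , x≐s′) = s′ , trans≐ s≐x x≐s′ , λ _ → refl
  ... | no x∉P = contradiction (s , sym≐ s≐x) x∉P

module Preservation (em : ∀ {ℓ} → ExcludedMiddle ℓ) {X τ P L : V}
  (isPoset : IsPoset P L) (menger : Menger X τ) where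

  open IsPoset isPoset using (poset)
  open Poset poset using (_≤_; reflexive) renaming (refl to ≤-refl; trans to ≤-trans)
  open Forcing poset
  open Interpretation forced using (Ω; _∈̇_; _∧̇_; _⇒̇_; ∀̇; ∃̇)
  open SetLanguage forced
  open StrongProperness isPoset
  open ForcingProperties poset
  open Finite em
  open Countability em

  Cond : Set
  Cond = Index P

  module Sequence (σ u : Name) (p : Cond)
    (basis : IsBasis (check τ) σ p)
    (u-function : IsFunctionOn u (check ω) p)
    (u-covers : ∀ n q → q ≤ p → Lift (lsuc 0ℓ) (q ⊩ n ∈ check ω) → ∀ 𝒰 r → r ≤ q →
      (u ⟨ n ⟩↦ 𝒰) r → IsOpenCover (check X) σ 𝒰 r) where

    Selects Covers : Name → Ω
    Selects f = ∀∈ (check ω) λ n → ∀̇ λ 𝒰 → ∀̇ λ F →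
      (u ⟨ n ⟩↦ 𝒰 ∧̇ f ⟨ n ⟩↦ F) ⇒̇ (F ⊆̇ 𝒰 ∧̇ IsFinite (check ω) F)
    Covers f = ∀∈ (check X) λ x → ∃∈ (check ω) λ n → ∃̇ λ F →
      f ⟨ n ⟩↦ F ∧̇ (∃∈ F λ U → x ∈̇ U)

    -- The name `U` is part of the data, because these names become the members of the selected
    -- finite families.
    Refines : ℕ → Index τ → Cond → Set₁
    Refines n B r = ∃ λ 𝒰 → ∃ λ U →
      (u ⟨ check (numeral n) ⟩↦ 𝒰) r × r ⊩ U ∈ 𝒰 × (check (elem τ B) ⊆̇ U) r

    numeral∈ω : ∀ {q} n → q ⊩ check (numeral n) ∈ check ω
    numeral∈ω n = check-∈⁺ (numeral n) ω (n , refl≐ {numeral n})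

    u-unique : ∀ {q} n 𝒰 𝒰′ → q ≤ p → (u ⟨ check (numeral n) ⟩↦ 𝒰) q →
      (u ⟨ check (numeral n) ⟩↦ 𝒰′) q → q ⊩ 𝒰 ≐ 𝒰′
    u-unique n 𝒰 𝒰′ q≤p h h′ = ⊩≐-dense 𝒰 𝒰′
      (dense-map (proj₂ u-function (check (numeral n)) _ q≤p (lift (numeral∈ω n)))
        λ r r≤q (y , _ , unique) →
          ⊩≐-trans 𝒰 y 𝒰′
            (lower (unique 𝒰 r ≤-refl (dense-mono r≤q h)))
            (⊩≐-sym 𝒰′ y (lower (unique 𝒰′ r ≤-refl (dense-mono r≤q h′)))))

    -- Four extensions in turn: `r₁` names the cover `u(n)`, `r₂` a member `U` containing `x`, `r₃`
    -- a basic `W` between `x` and `U`, and `r₄` decides which `B` of V this `W` is.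
    refines-dense : ∀ n x s → s ≤ p →
      ∃[ r ] r ≤ s × (∃ λ B → elem X x ∈ elem τ B × Refines n B r)
    refines-dense n x s s≤p
      with r₁ , r₁≤s , 𝒰 , u↦𝒰 , _ ←
             proj₂ u-function (check (numeral n)) s s≤p (lift (numeral∈ω n)) s ≤-refl
      with 𝒰⊆σ , 𝒰-covers ←
             u-covers (check (numeral n)) s s≤p (lift (numeral∈ω n)) 𝒰 r₁ r₁≤s u↦𝒰
      with r₂ , r₂≤r₁ , U , lift U∈𝒰 , lift x∈U ←
             𝒰-covers (check (elem X x)) r₁ ≤-refl
               (lift (check-∈⁺ (elem X x) X (elem∈ X x))) r₁ ≤-refl
      with r₂≤p ← ≤-trans r₂≤r₁ (≤-trans r₁≤s s≤p)
      with r₃ , r₃≤r₂ , W , lift W∈τ , lift x∈W , W⊆U ←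
             proj₂ basis U r₂ r₂≤p (𝒰⊆σ U r₂ r₂≤r₁ (lift U∈𝒰))
               (check (elem X x)) r₂ ≤-refl (lift x∈U) r₂ ≤-refl
      with r₄ , r₄≤r₃ , B , W≐B ← check-∈⁻ {a = W} τ W∈τ r₃ ≤-refl
      with r₄≤r₂ ← ≤-trans r₄≤r₃ r₃≤r₂ =
      r₄ , ≤-trans r₄≤r₂ (≤-trans r₂≤r₁ r₁≤s) ,
      B , check-∈ (elem X x) (elem τ B)
            (⊩∈-congʳ (check (elem X x)) W (check (elem τ B)) W≐B
              (⊩∈-mono (check (elem X x)) W r₄≤r₃ x∈W)) ,
      𝒰 , U , dense-mono (≤-trans r₄≤r₂ r₂≤r₁) u↦𝒰 , ⊩∈-mono U 𝒰 r₄≤r₂ U∈𝒰 ,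
      λ v q q≤r₄ (lift v∈B) → W⊆U v q (≤-trans q≤r₄ r₄≤r₃)
        (lift (⊩∈-congʳ v (check (elem τ B)) W
          (⊩≐-sym W (check (elem τ B)) (⊩≐-mono W (check (elem τ B)) q≤r₄ W≐B)) v∈B))

    -- For each `n` the Menger property is applied to the constant sequence with value `𝒲 n`, which
    -- yields a countable subcover. The conditions below the common extension `t` already make `𝒲 n`
    -- a cover.
    countable-refinement : ∀ s → Compatible s p →
      ∃ λ (ρ : ℕ → Cond) → ∀ n x → ∃[ k ] ρ k ≤ s × ∃ λ B → elem X x ∈ elem τ B × Refines n B (ρ k)
    countable-refinement s (t , t≤s , t≤p) = refinement
      (λ n → menger-selection em {X} {τ} menger (λ _ → 𝒲 n) (λ _ → 𝒲-covers n))
      where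
      𝒲 : ℕ → Index τ → Set₁
      𝒲 n B = ∃[ r ] r ≤ s × Refines n B r

      𝒲-covers : ∀ n x → ∃ λ B → 𝒲 n B × elem X x ∈ elem τ B
      𝒲-covers n x = let r , r≤t , B , x∈B , h = refines-dense n x t t≤p in
        B , (r , ≤-trans r≤t t≤s , h) , x∈B

      condition : ∀ n → ∃ (𝒲 n) → Cond
      condition n (_ , r , _) = r

      Covered : ℕ → Index X → Cond → Set₁
      Covered n x r = r ≤ s × ∃ λ B → elem X x ∈ elem τ B × Refines n B r

      refinement : (∀ n → Σ (ℕ → List (∃ (𝒲 n))) λ E →
          ∀ x → ∃[ j ] Any (λ (B , _) → elem X x ∈ elem τ B) (E j)) →
        ∃ λ (ρ : ℕ → Cond) → ∀ n x → ∃[ k ] Covered n x (ρ k)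
      refinement select =
        let ρ , ρ-covers = flatten s λ n j → List-map (condition n) (proj₁ (select n) j)
        in ρ , λ n x → let j , any = proj₂ (select n) x in
             ρ-covers (Covered n x) n j
               (map⁺ (Any-map (λ { {B , _ , r≤s , h} x∈B → r≤s , B , x∈B , h }) any))

    -- The sequences are chosen for all `s` at once, so that models can be closed under the choice.
    -- If `s` is incompatible with `p`, the constant sequence `s` is a default.
    refinement-step : ∃ λ (step : Cond → ℕ → Cond) → ∀ s → Compatible s p →
      ∀ n x → ∃[ k ] step s k ≤ s × ∃ λ B → elem X x ∈ elem τ B × Refines n B (step s k)
    refinement-step =
      (λ s → proj₁ (choose s em)) , (λ s → proj₂ (choose s em))
      where
      choose : ∀ s → Dec (Compatible s p) → ∃ λ (ρ : ℕ → Cond) → Compatible s p →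
        ∀ n x → ∃[ k ] ρ k ≤ s × ∃ λ B → elem X x ∈ elem τ B × Refines n B (ρ k)
      choose s (yes c) = let ρ , h = countable-refinement s c in ρ , λ _ → h
      choose s (no ¬c) = (λ _ → s) , λ c → contradiction c ¬c

    module Generic (M : V) (countable : IsCountable M) (p̄ : Cond) (p̄≤p : p̄ ≤ p)
      (generic : StronglyGeneric M p̄)
      (refines∈M : ∀ s → s ∈ᴾ M → Compatible s p → ∀ n x →
        ∃[ r ] r ∈ᴾ M × r ≤ s × ∃ λ B → elem X x ∈ elem τ B × Refines n B r) where

      Entry : ℕ → Set₁
      Entry n = ∃[ r ] r ∈ᴾ M × ∃ λ B → Refines n B r

      _below_∋_ : ∀ {n} → Entry n → Cond → Index X → Set
      (r , _ , B , _) below s ∋ x = r ≤ s × elem X x ∈ elem τ B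

      -- The map `i` picks out the block of indices reserved for `s`. Entries forget the bound
      -- `r ≤ s`, as those for different `s` end up in a common family; `_below_∋_` records it
      -- instead.
      selection : ∀ s → s ∈ᴾ M → Compatible s p → (i : ℕ → ℕ) →
        Σ (∀ n → List (Entry (i n))) λ E → ∀ x → ∃[ n ] Any (_below s ∋ x) (E n)
      selection s s∈M c i =
        let E , covers = menger-selection em {X} {τ} menger
              (λ n B → ∃[ r ] r ∈ᴾ M × r ≤ s × Refines (i n) B r)
              (λ n x → let r , r∈M , r≤s , B , x∈B , h = refines∈M s s∈M c (i n) x in
                B , (r , r∈M , r≤s , h) , x∈B)
        in (λ n → List-map (λ (B , r , r∈M , _ , h) → r , r∈M , B , h) (E n)) ,
           λ x → let n , any = covers x in
             n , map⁺ (Any-map (λ { {B , r , r∈M , r≤s , h} x∈B → r≤s , x∈B }) any)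

      -- An element of `M` that is no condition compatible with `p` receives empty lists. Otherwise
      -- one index `s` of `y` is used, and reflexivity of the order transfers the bound to any other
      -- index of `y`.
      element-selection : ∀ y → y ∈ M → Dec (∃[ s ] elem P s ≐ y × Compatible s p) → (i : ℕ → ℕ) →
        Σ (∀ n → List (Entry (i n))) λ E → ∀ s → elem P s ≐ y → Compatible s p →
          ∀ x → ∃[ n ] Any (_below s ∋ x) (E n)
      element-selection y y∈M (no ¬s) i = (λ _ → []) , λ s s≐y c → contradiction (s , s≐y , c) ¬s
      element-selection y y∈M (yes (s , s≐y , c)) i =
        let E , covers = selection s (∈-congˡ M s≐y y∈M) c i in
        E , λ s′ s′≐y _ x → let n , any = covers x in
          n , Any-map {P = _below s ∋ x} {Q = _below s′ ∋ x}
            (λ (r≤s , x∈B) → ≤-trans r≤s (reflexive {s} {s′}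
              (trans≐ {elem P s} {y} {elem P s′} s≐y (sym≐ {elem P s′} {y} s′≐y))) , x∈B) any

      collect : (e : ℕ → Index M) → (∀ {y} → y ∈ M → ∃[ k ] y ≐ elem M (e k)) →
        ∃ λ (G : ∀ n → List (Entry n)) →
          ∀ s → s ∈ᴾ M → Compatible s p → ∀ x → ∃[ n ] Any (_below s ∋ x) (G n)
      collect e surjective = G , λ s s∈M c x →
        let k , s≐k = surjective s∈M
            n , any = proj₂ (block k) s s≐k c x
        in pair k n , subst (Any (_below s ∋ x)) (sym (G-pair k n)) any
        where
        block : ∀ k → Σ (∀ n → List (Entry (pair k n))) λ E →
          ∀ s → elem P s ≐ elem M (e k) → Compatible s p → ∀ x → ∃[ n ] Any (_below s ∋ x) (E n)
        block k = element-selection (elem M (e k)) (elem∈ M (e k)) em (pair k)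

        reindexed : ∃ λ (G : ∀ n → List (Entry n)) → ∀ k n → G (pair k n) ≡ proj₁ (block k) n
        reindexed = reindex (λ _ → []) λ k n → proj₁ (block k) n

        G : ∀ n → List (Entry n)
        G = proj₁ reindexed

        G-pair : ∀ k n → G (pair k n) ≡ proj₁ (block k) n
        G-pair = proj₂ reindexed

      families : ∃ λ (G : ∀ n → List (Entry n)) →
        ∀ s → s ∈ᴾ M → Compatible s p → ∀ x → ∃[ n ] Any (_below s ∋ x) (G n)
      families = let e , surjective , _ = enumerate {M} countable in collect e surjective

      module Selector (G : ∀ n → List (Entry n))
        (G-covers : ∀ s → s ∈ᴾ M → Compatible s p → ∀ x → ∃[ n ] Any (_below s ∋ x) (G n)) where

        condition : ∀ n → Fin (length (G n)) → Cond
        condition n j = proj₁ (lookup (G n) j)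

        refined : ∀ n j → Refines n (proj₁ (proj₂ (proj₂ (lookup (G n) j)))) (condition n j)
        refined n j = proj₂ (proj₂ (proj₂ (lookup (G n) j)))

        U : ∀ n → Fin (length (G n)) → Name
        U n j = proj₁ (proj₂ (refined n j))

        -- Each `U n j` is paired with the condition of its entry, so `F n` denotes the set of those
        -- `U n j` whose condition is in the generic filter.
        F : ℕ → Name
        F n = name (Fin (length (G n))) (U n) (condition n)

        f : Name
        f = graphᴺ numeral F

        -- The condition of the entry forces `U n j` into some value `𝒰′` of `u` at `n`; uniqueness
        -- of values identifies `𝒰′` with `𝒰`.
        F⊆ : ∀ {q} n 𝒰 → q ≤ p → (u ⟨ check (numeral n) ⟩↦ 𝒰) q →
          ∀ v → q ⊩ v ∈ F n → q ⊩ v ∈ 𝒰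
        F⊆ n 𝒰 q≤p u↦𝒰 v v∈F = ⊩∈-dense v 𝒰 (dense-map v∈F λ r r≤q (j , r≤c , v≐U) →
          let 𝒰′ , U′ , u↦𝒰′ , U∈𝒰′ , _ = refined n j in
          ⊩∈-congˡ v (U n j) 𝒰 v≐U
            (⊩∈-congʳ (U n j) 𝒰′ 𝒰
              (u-unique n 𝒰′ 𝒰 (≤-trans r≤q q≤p) (dense-mono r≤c u↦𝒰′) (dense-mono r≤q u↦𝒰))
              (⊩∈-mono (U n j) 𝒰′ r≤c U∈𝒰′)))

        f-function : IsFunctionOn f (check ω) p̄
        f-function = graphᴺ-function numeral F numeral-injective ω
          (λ n → n , refl≐ {numeral n}) (λ x∈ω → x∈ω) p̄

        f-finite : ∀ x q → q ≤ p̄ → ∀ 𝒰 F′ → (u ⟨ x ⟩↦ 𝒰) q → (f ⟨ x ⟩↦ F′) q →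
          (F′ ⊆̇ 𝒰) q × IsFinite (check ω) F′ q
        f-finite x q q≤p̄ 𝒰 F′ u↦𝒰 f↦F′ =
          (λ v r r≤q (lift v∈F′) → lift (⊩∈-dense v 𝒰
            (dense-map (dense-mono r≤q values) λ r′ r′≤r (n , x≐n , F′≐F) →
              F⊆ n 𝒰 (≤-trans r′≤r (≤-trans r≤q (≤-trans q≤p̄ p̄≤p)))
                (↦-cong u x (check (numeral n)) 𝒰 x≐n (dense-mono (≤-trans r′≤r r≤q) u↦𝒰))
                v (⊩∈-congʳ v F′ (F n) F′≐F (⊩∈-mono v F′ r′≤r v∈F′))))) ,
          dense-bind values λ r r≤q (n , _ , F′≐F) →
            finite-cong F′ (F n) F′≐F (finite-name (U n) (condition n) r)
          where
          values : DenseBelow q λ r → ∃[ n ] r ⊩ x ≐ check (numeral n) × r ⊩ F′ ≐ F n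
          values = graphᴺ-↦⁻ numeral F x F′ f↦F′

        Covered : Name → Cond → Set₁
        Covered x q = (∃∈ (check ω) λ n → ∃̇ λ F′ → (f ⟨ n ⟩↦ F′) ∧̇ (∃∈ F′ λ W → x ∈̇ W)) q

        -- The entry's condition `c` is in `M` and below the residue `s` of `t`, hence compatible
        -- with `t`. A common extension forces `U n j` into `F n` and `x` into `B`, which is
        -- contained in `U n j`.
        residue-covers : ∀ {x t} s a n (j : Fin (length (G n))) → IsResidue M t s →
          lookup (G n) j below s ∋ a → t ⊩ x ≐ check (elem X a) →
          ∃[ r ] r ≤ t × ∃ λ m → Lift (lsuc 0ℓ) (r ⊩ m ∈ check ω) ×
            (∃̇ λ F′ → (f ⟨ m ⟩↦ F′) ∧̇ (∃∈ F′ λ W → x ∈̇ W)) r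
        residue-covers {x} {t} s a n j (_ , residue) (c≤s , a∈B) x≐a =
          let c , c∈M , B , _ = lookup (G n) j
              _ , _ , _ , _ , B⊆U = refined n j
              r , r≤c , r≤t = residue c c≤s c∈M
          in r , r≤t , check (numeral n) , lift (numeral∈ω n) ,
             dense-return λ r₁ r₁≤r → F n ,
               graphᴺ-↦⁺ numeral F (check (numeral n)) n (⊩≐-refl (check (numeral n))) ,
               dense-return λ r₂ r₂≤r₁ →
                 let r₂≤r = ≤-trans r₂≤r₁ r₁≤r
                     r₂≤c = ≤-trans r₂≤r r≤c
                 in U n j , lift (⊩∈-name {f = U n} {condition n} j r₂≤c) ,
                    B⊆U x r₂ r₂≤c (lift (⊩∈-congˡ x (check (elem X a)) (check (elem τ B))
                      (⊩≐-mono x (check (elem X a)) (≤-trans r₂≤r r≤t) x≐a)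
                      (check-∈⁺ (elem X a) (elem τ B) a∈B)))

        f-covers : ∀ x q → q ≤ p̄ → Lift (lsuc 0ℓ) (q ⊩ x ∈ check X) → Covered x q
        f-covers x q q≤p̄ (lift x∈X) = dense-bind (check-∈⁻ X x∈X) λ r r≤q (a , x≐a) t t≤r →
          let t≤p̄ = ≤-trans t≤r (≤-trans r≤q q≤p̄)
              s , residue = generic t t≤p̄
              -- The residue property at `s` itself: `s` is compatible with `t`, hence with `p`, as
              -- `G-covers` demands.
              t′ , t′≤s , t′≤t = proj₂ residue s ≤-refl (proj₁ residue)
              n , any = G-covers s (proj₁ residue)
                (t′ , t′≤s , ≤-trans t′≤t (≤-trans t≤p̄ p̄≤p)) a
          in residue-covers {x} s a n (index any) residue (lookup-index any)
               (⊩≐-mono x (check (elem X a)) t≤r x≐a)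

        selector : ∃ λ f → (IsFunctionOn f (check ω) ∧̇ Selects f ∧̇ Covers f) p̄
        selector = f , f-function ,
          (λ x q q≤p̄ _ 𝒰 F′ r r≤q (u↦𝒰 , f↦F′) →
            f-finite x r (≤-trans r≤q q≤p̄) 𝒰 F′ u↦𝒰 f↦F′) ,
          f-covers

  open Extension em P using (extend; extend-H; extend-elem)

  elem∈H : ∀ θ → H θ ⟨ P , L ⟩ → ∀ s → H θ (elem P s)
  elem∈H θ PL∈H s = H-elem θ P s (H-elem θ ｛ P , P ｝ true (H-elem θ ⟨ P , L ⟩ true PL∈H))

  forcesMenger : ∀ θ → H θ ⟨ P , L ⟩ →
    IsStationary θ (StronglyProperModel θ) → ForcesMenger X τ
  forcesMenger θ PL∈H stationary _ σ q _ (_ , basis) = dense-return λ q₁ q₁≤q →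
    check ω , checkω-isω q₁ , λ u q₂ q₂≤q₁ (u-function , u-covers) p p≤q₂ →
      -- The existence of `f` is a density statement below `q₂`. Here `p` is an arbitrary condition
      -- below `q₂`, and the strongly generic `p̄` is the required extension.
      let p≤q = ≤-trans p≤q₂ (≤-trans q₂≤q₁ q₁≤q) in
      model-selector σ u p
        ((λ v r r≤p → proj₁ basis v r (≤-trans r≤p p≤q)) ,
         (λ U r r≤p → proj₂ basis U r (≤-trans r≤p p≤q)))
        ((λ z r r≤p → proj₁ u-function z r (≤-trans r≤p p≤q₂)) ,
         (λ n r r≤p → proj₂ u-function n r (≤-trans r≤p p≤q₂)))
        (λ n r r≤p → u-covers n r (≤-trans r≤p p≤q₂))
    where
    model-selector : ∀ σ u p (basis : IsBasis (check τ) σ p) (u-function : IsFunctionOn u (check ω) p)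
      (u-covers : ∀ n q → q ≤ p → Lift (lsuc 0ℓ) (q ⊩ n ∈ check ω) → ∀ 𝒰 r → r ≤ q →
        (u ⟨ n ⟩↦ 𝒰) r → IsOpenCover (check X) σ 𝒰 r) →
      let open Sequence σ u p basis u-function u-covers in
      ∃[ r ] r ≤ p × ∃ λ f → (IsFunctionOn f (check ω) ∧̇ Selects f ∧̇ Covers f) r
    model-selector σ u p basis u-function u-covers =
      let step , step-refines = refinement-step
          M , (_ , p∈M , closed) , countable , _ , _ , proper =
            -- Taking `p` as the distinguished element of the club puts it into `M`, so that strong
            -- properness applies below `p`.
            stationary _ (closedUnder-club {θ} {elem P p} (extend step) (elem∈H θ PL∈H p)
              (extend-H step θ (elem∈H θ PL∈H)))
          p̄ , p̄≤p , generic = proper p p∈M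
          refines∈M : ∀ s → s ∈ᴾ M → Compatible s p → ∀ n x →
            ∃[ r ] r ∈ᴾ M × r ≤ s × ∃ λ B → elem X x ∈ elem τ B × Refines n B r
          refines∈M = λ s s∈M (t , t≤s , t≤p) n x →
            -- `M` is closed at a representative `y` of the condition `s`, and the step is taken at
            -- the index `s′` found for `y`; the order does not distinguish `s` from `s′`.
            let y , s≐y , extend∈M = closed (elem P s) s∈M
                s′ , s≐s′ , extend≡ = extend-elem step s y s≐y
                k , r≤s′ , h = step-refines s′ (t , ≤-trans t≤s (reflexive s≐s′) , t≤p) n x
            in step s′ k , subst (_∈ M) (extend≡ k) (extend∈M k) ,
               ≤-trans r≤s′ (reflexive (sym≐ s≐s′)) , h
          G , G-covers = Generic.families M countable p̄ p̄≤p generic refines∈M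
      in p̄ , p̄≤p , Generic.Selector.selector M countable p̄ p̄≤p generic refines∈M G G-covers
      where open Sequence σ u p basis u-function u-covers

theorem5p7 : (∀ {ℓ} → ExcludedMiddle ℓ) → (∀ {a ℓ} → Choice a ℓ) →
    (θ X τ P L : V) →
    IsRegular θ →
    IsTopologyOn X τ →
    (isPoset : IsPoset P L) →
    LargeEnough θ X τ P →
    H θ ⟨ X , τ ⟩ →
    H θ ⟨ P , L ⟩ →
    Menger X τ →
    IsStationary θ (StrongProperness.StronglyProperModel isPoset θ) →
    Forcing.ForcesMenger (IsPoset.poset isPoset) X τ
theorem5p7 em _ θ X τ P L _ _ isPoset _ _ PL∈H menger stationary =
  Preservation.forcesMenger em {X} {τ} isPoset menger θ PL∈H stationary
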